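{- Let $n\geq 10$ be an integer with $n\equiv 1\pmod 3$. Let $\hat{L}$ be the $n\times n$ matrix $$\hat{L}=\frac{n-1}{3}I_n-\frac13\begin{bmatrix}0&\mathbf{e}'\\ \mathbf{e}&\mathbf{0}\end{bmatrix}+\begin{bmatrix}0&\mathbf{0}'\\ \mathbf{0}&P\end{bmatrix},$$ where $P$ is the $(n-1)\times(n-1)$ circulant matrix defined in the context. Then the rank of $\hat{L}$ is $n-3$.
   Context: The prime denotes transpose, $I_n$ is the identity matrix, and $\mathbf{e}$ denotes the all-ones column vector (here in $\mathbb{R}^{n-1}$). In the block matrices the blocks have sizes $1$ and $n-1$. For a vector $\mathbf{c}=(c_1,\dots,c_m)'$, $\operatorname{Circ}(\mathbf{c}')$ is the $m\times m$ circulant matrix with first row $(c_1,\dots,c_m)$ and each subsequent row the cyclic right shift by one of the previous row. Definition of $P$ (for $n\equiv 1\pmod 3$, $n\ge 10$). Let $\mathbf{e_i}$ be the $i$-th standard basis vector of $\mathbb{R}^{n-1}$ and $\mathbf{c_k}=\mathbf{e_{k+1}}+\mathbf{e_{n-k}}\in\mathbb{R}^{n-1}$, for $1\le k\le \frac{n-2}{2}$ if $n$ is even and $1\le k\le\frac{n-3}{2}$ if $n$ is odd. If $n$ is even, $P=\frac{1}{3(n-1)}\operatorname{Circ}(\mathbf{z_1}')$ with $$\mathbf{z_1}=(2n-n^2)\mathbf{e_1}+\sum_{k=1}^{\frac{n-4}{6}}\left(\frac{3n-18k+8}{2}\mathbf{c_{3k-2}}-\frac{3n-18k+4}{2}\mathbf{c_{3k-1}}+\mathbf{c_{3k}}\right)+\mathbf{c_{\frac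 n2-1}}.$$ If $n$ is odd, $P=\frac{1}{3(n-1)}\operatorname{Circ}(\mathbf{z_2}')$ with $$\mathbf{z_2}=(2n-n^2)\mathbf{e_1}+\sum_{k=1}^{\frac{n-1}{6}}\left(\frac{3n-18k+8}{2}\mathbf{c_{3k-2}}-\frac{3n-18k+4}{2}\mathbf{c_{3k-1}}\right)+\sum_{k=1}^{\frac{n-7}{6}}\mathbf{c_{3k}}+\mathbf{e_{\frac{n+1}{2}}}.$$ -}

module Defs where

open import Data.Bool.Base using (if_then_else_)
open import Data.Fin.Base as Fin using (Fin; toℕ)
import Data.Fin.Properties as Fin
open import Data.Integer.Base as ℤ using (ℤ; +_)
open import Data.Nat.Base as ℕ using (ℕ; zero; suc; _∸_)
open import Data.Nat.Divisibility using (_∣?_)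
import Data.Nat.DivMod as ℕ
import Data.Nat.Properties as ℕ
open import Data.Product.Base using (∃-syntax)
open import Data.Rational.Base using (ℚ; 0ℚ; 1ℚ; _+_; _*_; _-_; _/_)
open import Data.Rational.Properties using (+-0-commutativeMonoid)
open import Data.Vec.Functional
  using (Vector; replicate; map; zipWith; transpose; _∷_)
open import Algebra.Properties.CommutativeMonoid.Sum +-0-commutativeMonoid
  using (sum)
open import Relation.Binary.PropositionalEquality.Core using (_≡_; _≗_)
open import Relation.Nullary.Decidable.Core using (does)

Matrix : ℕ → ℕ → Set
Matrix m n = Vector (Vector ℚ n) m

infixl 6 _+ᵥ_ _-ᵥ_ _+ₘ_ _-ₘ_
infixl 7 _*ᵥ_ _*ₘ_

0ᵥ : ∀ {n} → Vector ℚ n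
0ᵥ = replicate _ 0ℚ

_+ᵥ_ _-ᵥ_ : ∀ {n} → Vector ℚ n → Vector ℚ n → Vector ℚ n
_+ᵥ_ = zipWith _+_
_-ᵥ_ = zipWith _-_

_*ᵥ_ : ∀ {n} → ℚ → Vector ℚ n → Vector ℚ n
q *ᵥ v = map (q *_) v

0ₘ : ∀ {m n} → Matrix m n
0ₘ = replicate _ 0ᵥ

_+ₘ_ _-ₘ_ : ∀ {m n} → Matrix m n → Matrix m n → Matrix m n
_+ₘ_ = zipWith _+ᵥ_
_-ₘ_ = zipWith _-ᵥ_

_*ₘ_ : ∀ {m n} → ℚ → Matrix m n → Matrix m n
q *ₘ A = map (q *ᵥ_) A

I : ∀ n → Matrix n n
I n i j = if does (i Fin.≟ j) then 1ℚ else 0ℚ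

-- The matrix [ a  r′ ; c  D ].
block : ∀ {m} → ℚ → Vector ℚ m → Vector ℚ m → Matrix m m →
        Matrix (suc m) (suc m)
block a r c D = (a ∷ r) ∷ zipWith _∷_ c D

-- Entry (i , j), counted from 0, is entry j - i (mod m) of the first row.
Circ : ∀ {m} → Vector ℚ m → Matrix m m
Circ {suc m} v i j = v ((toℕ j ℕ.+ (suc m ∸ toℕ i)) ℕ.mod suc m)

lincomb : ∀ {r m} → Vector ℚ r → Vector (Vector ℚ m) r → Vector ℚ m
lincomb a b i = sum (λ k → a k * b k i)

LinearlyIndependent : ∀ {r m} → Vector (Vector ℚ m) r → Set
LinearlyIndependent b = ∀ a → lincomb a b ≗ 0ᵥ → a ≗ 0ᵥ

infix 4 _∈Span_

_∈Span_ : ∀ {r m} → Vector ℚ m → Vector (Vector ℚ m) r → Set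
v ∈Span b = ∃[ a ] lincomb a b ≗ v

-- The column space of A has dimension r, i.e. it has a basis of r vectors.
-- For a matrix with rational entries this is also its rank over ℝ.
record HasRank {m n} (A : Matrix m n) (r : ℕ) : Set where
  field
    basis       : Vector (Vector ℚ m) r
    inColSpace  : ∀ k → basis k ∈Span transpose A
    independent : LinearlyIndependent basis
    spanning    : ∀ v → v ∈Span transpose A → v ∈Span basis

-- ∑[1… N ] f  is  f 1 + ⋯ + f N.
∑[1…_] : ∀ {m} → ℕ → (ℕ → Vector ℚ m) → Vector ℚ m
∑[1… N ] f j = sum {N} (λ k → f (suc (toℕ k)) j)

-- The standard basis vector of ℚᵐ, indexed from 1.
e : ∀ {m} → ℕ → Vector ℚ m
e i j = if does (i ℕ.≟ suc (toℕ j)) then 1ℚ else 0ℚ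

c : ∀ n → ℕ → Vector ℚ (n ∸ 1)
c n k = e (k ℕ.+ 1) +ᵥ e (n ∸ k)

-- (3n - 18k + d) / 2, which is a half-integer when n is odd and d is even.
coeff : ℕ → ℕ → ℕ → ℚ
coeff d n k = (+ (3 ℕ.* n) ℤ.- + (18 ℕ.* k) ℤ.+ + d) / 2

diagCoeff : ℕ → ℚ
diagCoeff n = (+ (2 ℕ.* n) ℤ.- + (n ℕ.* n)) / 1

-- Since n ≡ 1 (mod 3), the natural-number divisions in z₁ are exact for even n
-- and those in z₂ are exact for odd n.
z₁ : ∀ n → Vector ℚ (n ∸ 1)
z₁ n = diagCoeff n *ᵥ e 1
    +ᵥ ∑[1… (n ∸ 4) ℕ./ 6 ] (λ k →
            coeff 8 n k *ᵥ c n (3 ℕ.* k ∸ 2)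
         -ᵥ coeff 4 n k *ᵥ c n (3 ℕ.* k ∸ 1)
         +ᵥ c n (3 ℕ.* k))
    +ᵥ c n (n ℕ./ 2 ∸ 1)

z₂ : ∀ n → Vector ℚ (n ∸ 1)
z₂ n = diagCoeff n *ᵥ e 1
    +ᵥ ∑[1… (n ∸ 1) ℕ./ 6 ] (λ k →
            coeff 8 n k *ᵥ c n (3 ℕ.* k ∸ 2)
         -ᵥ coeff 4 n k *ᵥ c n (3 ℕ.* k ∸ 1))
    +ᵥ ∑[1… (n ∸ 7) ℕ./ 6 ] (λ k → c n (3 ℕ.* k))
    +ᵥ e ((n ℕ.+ 1) ℕ./ 2)

-- For n ≤ 1 the matrix has no entries.
P : ∀ n → Matrix (n ∸ 1) (n ∸ 1)
P 0 = λ ()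
P 1 = λ ()
P n@(suc (suc m)) =
  (+ 1 / (3 ℕ.* suc m)) *ₘ Circ (if does (2 ∣? n) then z₁ n else z₂ n)

L̂ : ∀ n → Matrix n n
L̂ zero = λ ()
L̂ n@(suc m) =
     (+ (n ∸ 1) / 3) *ₘ I n
  -ₘ (+ 1 / 3) *ₘ block 0ℚ (replicate m 1ℚ) (replicate m 1ℚ) 0ₘ
  +ₘ block 0ℚ 0ᵥ 0ᵥ (P n)

-- Put m = n - 1 = 3t.  The first row of 3m (m/3 I + P) is 1, (3m - 7)/2, -(3m - 11)/2, 1, …, and any
-- three cyclically consecutive entries sum to 3 or -6, except for 3m - 6 around position 0.
-- Hence, with C the cyclic shift, J all-ones and T the matrix of congruence mod 3,
-- (m/3 I + P)(C⁻¹ + I + C) = I + J/m - 3T/m.  So every (v₀ ; x) with v₀ + 3 (sum of a residue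
-- class of x) = 0 for all three classes mod 3 equals L̂ (0 ; (C⁻¹ + I + C) x), while the columns of L̂
-- satisfy these three independent equations: they define the column space.
module Submission where

open import Defs
open import Algebra.Bundles using (CommutativeRing)
open import Data.Bool.Base using (if_then_else_)
open import Data.Fin.Base as Fin using (Fin; zero; suc; toℕ)
import Data.Fin.Properties as Fin
open import Data.Integer.Base as ℤ using (ℤ)
import Data.Integer.Properties as ℤ
open import Data.Nat.Base as ℕ using (ℕ; zero; suc; _≤_; _<_; _∸_; s≤s)
open import Data.Nat.DivMod
  using (_%_; _mod_; _divMod_; result; [m+n]%n≡m%n; [m+kn]%n≡m%n; m%n<n; m<n⇒m%n≡m;
         m≡m%n+[m/n]*n; m%n%n≡m%n; n%n≡0; %-distribˡ-+; m*n/n≡m)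
open import Data.Nat.Divisibility using (_∣_; _∣?_; divides; m%n≡0⇒n∣m; n∣m⇒m%n≡0)
import Data.Nat.Properties as ℕ
open import Data.Nat.Tactic.RingSolver using (solve-∀)
open import Data.Product.Base using (_,_)
open import Data.Rational.Base using (ℚ; 0ℚ; 1ℚ; ½; _+_; _*_; _-_; -_; _/_)
import Data.Rational.Properties as ℚ
open import Data.Rational.Solver using (module +-*-Solver)
open +-*-Solver using (solve; _:=_; _:+_; _:*_; _:-_; :-_; con)
import Data.Rational.Unnormalised.Base as ℚᵘ
import Data.Rational.Unnormalised.Properties as ℚᵘ
open import Data.Vec.Functional using (Vector; _∷_; transpose)
open import Algebra.Properties.CommutativeMonoid.Sum ℚ.+-0-commutativeMonoid
  using (sum; sum-cong-≗; sum-replicate-zero; ∑-distrib-+; ∑-comm)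
open import Algebra.Properties.Semiring.Sum (CommutativeRing.semiring ℚ.+-*-commutativeRing)
  using (*-distribˡ-sum; *-distribʳ-sum)
open import Function.Base using (_∘_)
open import Relation.Binary.PropositionalEquality
open import Relation.Nullary.Decidable using (dec-true; dec-false)
open import Relation.Nullary.Decidable.Core using (Dec; does; yes; no)
open import Relation.Nullary.Negation.Core using (¬_; contradiction)
open ≡-Reasoning

-- The equations themselves make the preimage work. Let σ be the sum of x and τ its sum over the
-- residue class of i. Adding the three equations gives v₀ + σ = 0, so row 0 of L̂, which is -1/3
-- beyond its first entry, returns -σ = v₀. In row i the correction (σ - 3τ)/m vanishes, because σ
-- and 3τ both equal -v₀. In the other direction, the class sums of the row `ζ (3m)` all equal t, so
-- a column of L̂ after the first satisfies the equations by -1/3 + 3t/(3m) = 0. The two formulas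
-- for P describe one and the same row. A term in `c n k` puts one value at the positions k and m -
-- k, counted from 0, and `ζ (3m)` is palindromic. The sums therefore list half of the row and
-- reflect it; the single basis vector in `z₂` is the middle position, fixed by the reflection, that
-- exists when m is even. Parity is confined to this comparison.

-- Naturals and fractions in ℚ, in a form on which the ring solver computes

ι : ℕ → ℚ
ι zero    = 0ℚ
ι (suc n) = 1ℚ + ι n

ι-+ : ∀ m n → ι (m ℕ.+ n) ≡ ι m + ι n
ι-+ zero    n = sym (ℚ.+-identityˡ (ι n))
ι-+ (suc m) n = trans (cong (1ℚ +_) (ι-+ m n)) (sym (ℚ.+-assoc 1ℚ (ι m) (ι n)))

ι-* : ∀ m n → ι (m ℕ.* n) ≡ ι m * ι n
ι-* zero    n = sym (ℚ.*-zeroˡ (ι n))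
ι-* (suc m) n = begin
  ι (n ℕ.+ m ℕ.* n)    ≡⟨ ι-+ n (m ℕ.* n) ⟩
  ι n + ι (m ℕ.* n)    ≡⟨ cong (ι n +_) (ι-* m n) ⟩
  ι n + ι m * ι n      ≡⟨ solve 2 (λ a b → b :+ a :* b := (con 1ℚ :+ a) :* b) refl (ι m) (ι n) ⟩
  (1ℚ + ι m) * ι n     ∎

-- `_/_` reduces to lowest terms, which blocks computation, so the identity is checked on
-- unnormalised fractions, where it is cross-multiplication.
/-homo-+ : ∀ i j d .{{_ : ℕ.NonZero d}} → (i ℤ.+ j) / d ≡ i / d + j / d
/-homo-+ i j d@(suc d-1) = ℚ.toℚᵘ-injective
  (ℚᵘ.≃-trans (ℚ.toℚᵘ-fromℚᵘ (ℚᵘ.mkℚᵘ (i ℤ.+ j) d-1))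
  (ℚᵘ.≃-trans add
  (ℚᵘ.≃-sym (ℚᵘ.≃-trans (ℚ.toℚᵘ-homo-+ (i / d) (j / d))
    (ℚᵘ.+-cong (ℚ.toℚᵘ-fromℚᵘ (ℚᵘ.mkℚᵘ i d-1)) (ℚ.toℚᵘ-fromℚᵘ (ℚᵘ.mkℚᵘ j d-1)))))))
  where
  add : ℚᵘ.mkℚᵘ (i ℤ.+ j) d-1 ℚᵘ.≃ ℚᵘ.mkℚᵘ i d-1 ℚᵘ.+ ℚᵘ.mkℚᵘ j d-1
  add = ℚᵘ.*≡* (begin
    (i ℤ.+ j) ℤ.* (ℤ.+ d ℤ.* ℤ.+ d)              ≡⟨ ℤ.*-assoc (i ℤ.+ j) (ℤ.+ d) (ℤ.+ d) ⟨
    (i ℤ.+ j) ℤ.* ℤ.+ d ℤ.* ℤ.+ d                ≡⟨ cong (ℤ._* ℤ.+ d) (ℤ.*-distribʳ-+ (ℤ.+ d) i j) ⟩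
    (i ℤ.* ℤ.+ d ℤ.+ j ℤ.* ℤ.+ d) ℤ.* ℤ.+ d        ∎)

/-homo-neg : ∀ i d .{{_ : ℕ.NonZero d}} → (ℤ.- i) / d ≡ - (i / d)
/-homo-neg i d = begin
  (ℤ.- i) / d                    ≡⟨ solve 2 (λ a b → a := b :+ a :- b) refl ((ℤ.- i) / d) (i / d) ⟩
  i / d + (ℤ.- i) / d - i / d    ≡⟨ cong (_- i / d) (/-homo-+ i (ℤ.- i) d) ⟨
  (i ℤ.+ ℤ.- i) / d - i / d      ≡⟨ cong (λ k → k / d - i / d) (ℤ.+-inverseʳ i) ⟩
  ℤ.0ℤ / d - i / d               ≡⟨ cong (_- i / d) (ℚ.0/n≡0 d) ⟩
  0ℚ - i / d                     ≡⟨ ℚ.+-identityˡ (- (i / d)) ⟩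
  - (i / d)                      ∎

-- Makes every fraction with denominator `d` a multiple of the one atom `1 / d`, so that ring
-- identities remain.
+/≡ι*1/ : ∀ n d .{{_ : ℕ.NonZero d}} → ℤ.+ n / d ≡ ι n * (ℤ.+ 1 / d)
+/≡ι*1/ zero    d = trans (ℚ.0/n≡0 d) (sym (ℚ.*-zeroˡ (ℤ.+ 1 / d)))
+/≡ι*1/ (suc n) d = begin
  ℤ.+ suc n / d                    ≡⟨ /-homo-+ (ℤ.+ 1) (ℤ.+ n) d ⟩
  ℤ.+ 1 / d + ℤ.+ n / d              ≡⟨ cong (ℤ.+ 1 / d +_) (+/≡ι*1/ n d) ⟩
  ℤ.+ 1 / d + ι n * (ℤ.+ 1 / d)      ≡⟨ solve 2 (λ a b → b :+ a :* b := (con 1ℚ :+ a) :* b) refl (ι n) (ℤ.+ 1 / d) ⟩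
  (1ℚ + ι n) * (ℤ.+ 1 / d)         ∎

n/n≡1 : ∀ n .{{_ : ℕ.NonZero n}} → ℤ.+ n / n ≡ 1ℚ
n/n≡1 n@(suc n-1) = ℚ.fromℚᵘ-cong {ℚᵘ.mkℚᵘ (ℤ.+ n) n-1} {ℚᵘ.1ℚᵘ}
  (ℚᵘ.*≡* (trans (ℤ.*-identityʳ (ℤ.+ n)) (sym (ℤ.*-identityˡ (ℤ.+ n)))))

1/n*n≡1 : ∀ n .{{_ : ℕ.NonZero n}} → (ℤ.+ 1 / n) * ι n ≡ 1ℚ
1/n*n≡1 n = trans (ℚ.*-comm (ℤ.+ 1 / n) (ι n)) (trans (sym (+/≡ι*1/ n n)) (n/n≡1 n))

-- Sums over initial segments of ℕ and periodic sequences

S : ℕ → (ℕ → ℚ) → ℚ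
S N f = sum {N} (f ∘ toℕ)

S-last : ∀ N f → S (suc N) f ≡ S N f + f N
S-last zero    f = ℚ.+-comm (f 0) 0ℚ
S-last (suc N) f = trans (cong (f 0 +_) (S-last N (f ∘ suc))) (sym (ℚ.+-assoc (f 0) (S N (f ∘ suc)) (f (suc N))))

Periodic : ℕ → (ℕ → ℚ) → Set
Periodic N f = ∀ j → f (j ℕ.+ N) ≡ f j

-- Moving the window by one place drops `f s` and gains `f (N + s)`, which periodicity makes equal.
S-shift : ∀ N f → Periodic N f → ∀ s → S N (λ j → f (j ℕ.+ s)) ≡ S N f
S-shift N f p zero    = sum-cong-≗ {N} (λ j → cong f (ℕ.+-identityʳ (toℕ j)))
S-shift N f p (suc s) = begin
  S N (λ j → f (j ℕ.+ suc s))                   ≡⟨ sum-cong-≗ {N} (λ j → cong f (ℕ.+-suc (toℕ j) s)) ⟩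
  S N (λ j → f (suc j ℕ.+ s))                   ≡⟨ solve 2 (λ a b → b := a :+ b :- a) refl (f s) _ ⟩
  S (suc N) (λ j → f (j ℕ.+ s)) - f s           ≡⟨ cong (_- f s) (S-last N (λ j → f (j ℕ.+ s))) ⟩
  S N (λ j → f (j ℕ.+ s)) + f (N ℕ.+ s) - f s   ≡⟨ cong₂ (λ a b → a + b - f s) (S-shift N f p s) (trans (cong f (ℕ.+-comm N s)) (p s)) ⟩
  S N f + f s - f s                             ≡⟨ solve 2 (λ a b → b :+ a :- a := b) refl (f s) _ ⟩
  S N f                                         ∎

-- Residue classes mod 3 and the row sequence ζ

χ : ℕ → ℚ
χ 0 = 1ℚ
χ 1 = 0ℚ
χ 2 = 0ℚ
χ (suc (suc (suc j))) = χ j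

χ-total : ∀ d → χ d + χ (1 ℕ.+ d) + χ (2 ℕ.+ d) ≡ 1ℚ
χ-total 0 = refl
χ-total 1 = refl
χ-total 2 = refl
χ-total (suc (suc (suc d))) = χ-total d

χ-+3* : ∀ t d → χ (d ℕ.+ t ℕ.* 3) ≡ χ d
χ-+3* zero d = cong χ (ℕ.+-identityʳ d)
χ-+3* (suc t) d = begin
  χ (d ℕ.+ (3 ℕ.+ t ℕ.* 3)) ≡⟨ cong χ (ℕ.+-comm d (3 ℕ.+ t ℕ.* 3)) ⟩
  χ (t ℕ.* 3 ℕ.+ d)         ≡⟨ cong χ (ℕ.+-comm (t ℕ.* 3) d) ⟩
  χ (d ℕ.+ t ℕ.* 3)         ≡⟨ χ-+3* t d ⟩
  χ d                       ∎

-- Exactly one of the second factors is 1, according to k mod 3. This lets three dependent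
-- coordinates cancel a unit vector in `φ-freeBasis`.
χ-+ : ∀ k d → χ (k ℕ.+ d) ≡ χ d * χ k + χ (1 ℕ.+ d) * χ (2 ℕ.+ k) + χ (2 ℕ.+ d) * χ (1 ℕ.+ k)
χ-+ 0 d = solve 3 (λ a b c → a := a :* con 1ℚ :+ b :* con 0ℚ :+ c :* con 0ℚ) refl (χ d) (χ (1 ℕ.+ d)) (χ (2 ℕ.+ d))
χ-+ 1 d = solve 3 (λ a b c → b := a :* con 0ℚ :+ b :* con 1ℚ :+ c :* con 0ℚ) refl (χ d) (χ (1 ℕ.+ d)) (χ (2 ℕ.+ d))
χ-+ 2 d = solve 3 (λ a b c → c := a :* con 0ℚ :+ b :* con 0ℚ :+ c :* con 1ℚ) refl (χ d) (χ (1 ℕ.+ d)) (χ (2 ℕ.+ d))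
χ-+ (suc (suc (suc k))) d = χ-+ k d

-- ζ (3m) on 0, …, m - 1 is the first row of 3m (m/3 I + P).  The parameter is left free because
-- moving three places along the row amounts to lowering it by 18.
ζ : ℚ → ℕ → ℚ
ζ β 0 = 1ℚ
ζ β 1 = ½ * (β - ι 7)
ζ β 2 = ½ * (ι 11 - β)
ζ β (suc (suc (suc j))) = ζ (β - ι 18) j

ζ-3* : ∀ β t → ζ β (t ℕ.* 3) ≡ 1ℚ
ζ-3* β zero    = refl
ζ-3* β (suc t) = ζ-3* (β - ι 18) t

ζ-3*+1 : ∀ β t → ζ β (t ℕ.* 3 ℕ.+ 1) ≡ ½ * (β - ι 18 * ι t - ι 7)
ζ-3*+1 β zero = solve 1 (λ b → con ½ :* (b :- con (ι 7)) := con ½ :* (b :- con (ι 18) :* con 0ℚ :- con (ι 7))) refl β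
ζ-3*+1 β (suc t) = trans (ζ-3*+1 (β - ι 18) t)
  (solve 2 (λ b t → con ½ :* (b :- con (ι 18) :- con (ι 18) :* t :- con (ι 7))
     := con ½ :* (b :- con (ι 18) :* (con 1ℚ :+ t) :- con (ι 7))) refl β (ι t))

ζ-3*+2 : ∀ β t → ζ β (t ℕ.* 3 ℕ.+ 2) ≡ ½ * (ι 11 - (β - ι 18 * ι t))
ζ-3*+2 β zero = solve 1 (λ b → con ½ :* (con (ι 11) :- b) := con ½ :* (con (ι 11) :- (b :- con (ι 18) :* con 0ℚ))) refl β
ζ-3*+2 β (suc t) = trans (ζ-3*+2 (β - ι 18) t)
  (solve 2 (λ b t → con ½ :* (con (ι 11) :- (b :- con (ι 18) :- con (ι 18) :* t))
     := con ½ :* (con (ι 11) :- (b :- con (ι 18) :* (con 1ℚ :+ t)))) refl β (ι t))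

-- A window holds one entry of each kind, so β cancels. Only for j ≡ 2 do its two half-terms come
-- from different blocks, and there the drop of 18 in β costs 9.
ζ-three : ∀ β j → ζ β j + ζ β (1 ℕ.+ j) + ζ β (2 ℕ.+ j) ≡ ι 3 - ι 9 * χ (1 ℕ.+ j)
ζ-three β 0 = solve 1 (λ b → con 1ℚ :+ con ½ :* (b :- con (ι 7)) :+ con ½ :* (con (ι 11) :- b) := con (ι 3) :- con (ι 9) :* con 0ℚ) refl β
ζ-three β 1 = solve 1 (λ b → con ½ :* (b :- con (ι 7)) :+ con ½ :* (con (ι 11) :- b) :+ con 1ℚ := con (ι 3) :- con (ι 9) :* con 0ℚ) refl β
ζ-three β 2 = solve 1 (λ b → con ½ :* (con (ι 11) :- b) :+ con 1ℚ :+ con ½ :* (b :- con (ι 18) :- con (ι 7)) := con (ι 3) :- con (ι 9) :* con 1ℚ) refl β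
ζ-three β (suc (suc (suc j))) = ζ-three (β - ι 18) j

-- Two parameters serve the induction: stripping three places from one end lowers β by 18 and t by 1
-- and leaves β′ alone. The reflection of a row is the case β = β′ = 9t.
ζ-sym : ∀ β β′ t a b → a ℕ.+ b ≡ t ℕ.* 3 → β + β′ ≡ ι 18 * ι t → ζ β a ≡ ζ β′ b
ζ-sym β β′ t 0 b refl eq = sym (ζ-3* β′ t)
ζ-sym β β′ (suc t) 1 b a+b≡3t eq = begin
  ½ * (β - ι 7)                            ≡⟨ solve 2 (λ b b′ → con ½ :* (b :- con (ι 7)) := con ½ :* (b :+ b′ :- b′ :- con (ι 7))) refl β β′ ⟩
  ½ * (β + β′ - β′ - ι 7)                  ≡⟨ cong (λ x → ½ * (x - β′ - ι 7)) eq ⟩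
  ½ * (ι 18 * ι (suc t) - β′ - ι 7)        ≡⟨ solve 2 (λ b t → con ½ :* (con (ι 18) :* (con 1ℚ :+ t) :- b :- con (ι 7)) := con ½ :* (con (ι 11) :- (b :- con (ι 18) :* t))) refl β′ (ι t) ⟩
  ½ * (ι 11 - (β′ - ι 18 * ι t))           ≡⟨ ζ-3*+2 β′ t ⟨
  ζ β′ (t ℕ.* 3 ℕ.+ 2)                     ≡⟨ cong (ζ β′) (trans (ℕ.+-comm (t ℕ.* 3) 2) (sym (ℕ.suc-injective a+b≡3t))) ⟩
  ζ β′ b                                   ∎
ζ-sym β β′ (suc t) 2 b a+b≡3t eq = begin
  ½ * (ι 11 - β)                           ≡⟨ solve 2 (λ b b′ → con ½ :* (con (ι 11) :- b) := con ½ :* (con (ι 11) :- (b :+ b′) :+ b′)) refl β β′ ⟩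
  ½ * (ι 11 - (β + β′) + β′)               ≡⟨ cong (λ x → ½ * (ι 11 - x + β′)) eq ⟩
  ½ * (ι 11 - ι 18 * ι (suc t) + β′)       ≡⟨ solve 2 (λ b t → con ½ :* (con (ι 11) :- con (ι 18) :* (con 1ℚ :+ t) :+ b) := con ½ :* (b :- con (ι 18) :* t :- con (ι 7))) refl β′ (ι t) ⟩
  ½ * (β′ - ι 18 * ι t - ι 7)              ≡⟨ ζ-3*+1 β′ t ⟨
  ζ β′ (t ℕ.* 3 ℕ.+ 1)                     ≡⟨ cong (ζ β′) (trans (ℕ.+-comm (t ℕ.* 3) 1) (sym (ℕ.suc-injective (ℕ.suc-injective a+b≡3t)))) ⟩
  ζ β′ b                                   ∎
ζ-sym β β′ (suc t) (suc (suc (suc a))) b a+b≡3t eq =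
  ζ-sym (β - ι 18) β′ t a b (ℕ.suc-injective (ℕ.suc-injective (ℕ.suc-injective a+b≡3t))) (begin
    β - ι 18 + β′              ≡⟨ solve 2 (λ b b′ → b :- con (ι 18) :+ b′ := b :+ b′ :- con (ι 18)) refl β β′ ⟩
    β + β′ - ι 18              ≡⟨ cong (_- ι 18) eq ⟩
    ι 18 * ι (suc t) - ι 18    ≡⟨ solve 1 (λ t → con (ι 18) :* (con 1ℚ :+ t) :- con (ι 18) := con (ι 18) :* t) refl (ι t) ⟩
    ι 18 * ι t                 ∎)

-- The entries at 0 mod 3 are all 1; the other two classes are arithmetic progressions with steps -9
-- and 9. At β = 9t every class has average 1.
ζ-class : ∀ β t d → S (t ℕ.* 3) (λ j → χ (j ℕ.+ d) * ζ β j)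
  ≡ ι t * (χ d + χ (1 ℕ.+ d) * (½ * (β - ι 9 * ι t + ι 2)) + χ (2 ℕ.+ d) * (½ * (ι 9 * ι t + ι 2 - β)))
ζ-class β zero d = sym (ℚ.*-zeroˡ
  (χ d + χ (1 ℕ.+ d) * (½ * (β - ι 9 * 0ℚ + ι 2)) + χ (2 ℕ.+ d) * (½ * (ι 9 * 0ℚ + ι 2 - β))))
ζ-class β (suc t) d = trans (cong (λ x → χ d * 1ℚ + (χ (1 ℕ.+ d) * (½ * (β - ι 7)) + (χ (2 ℕ.+ d) * (½ * (ι 11 - β)) + x))) (ζ-class (β - ι 18) t d))
  (solve 5 (λ β t x y z → x :* con 1ℚ :+ (y :* (con ½ :* (β :- con (ι 7))) :+ (z :* (con ½ :* (con (ι 11) :- β)) :+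
     t :* (x :+ y :* (con ½ :* (β :- con (ι 18) :- con (ι 9) :* t :+ con (ι 2))) :+ z :* (con ½ :* (con (ι 9) :* t :+ con (ι 2) :- (β :- con (ι 18)))))))
     := (con 1ℚ :+ t) :* (x :+ y :* (con ½ :* (β :- con (ι 9) :* (con 1ℚ :+ t) :+ con (ι 2))) :+ z :* (con ½ :* (con (ι 9) :* (con 1ℚ :+ t) :+ con (ι 2) :- β))))
     refl β (ι t) (χ d) (χ (1 ℕ.+ d)) (χ (2 ℕ.+ d)))

sum-0 : ∀ {N} {f : Vector ℚ N} → (∀ i → f i ≡ 0ℚ) → sum f ≡ 0ℚ
sum-0 {N} f≡0 = trans (sum-cong-≗ f≡0) (sum-replicate-zero N)

S-cong : ∀ N {f g : ℕ → ℚ} → (∀ j → j < N → f j ≡ g j) → S N f ≡ S N g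
S-cong N f≡g = sum-cong-≗ {N} (λ i → f≡g (toℕ i) (Fin.toℕ<n i))

S-three : ∀ t f → S (t ℕ.* 3) f ≡ S t (λ s → f (s ℕ.* 3) + f (1 ℕ.+ s ℕ.* 3) + f (2 ℕ.+ s ℕ.* 3))
S-three zero    f = refl
S-three (suc t) f = trans
  (cong (λ x → f 0 + (f 1 + (f 2 + x))) (S-three t (f ∘ (3 ℕ.+_))))
  (solve 4 (λ a b c d → a :+ (b :+ (c :+ d)) := a :+ b :+ c :+ d) refl (f 0) (f 1) (f 2) _)

χ-sum : ∀ t d → S (t ℕ.* 3) (λ j → χ (j ℕ.+ d)) ≡ ι t
χ-sum zero    d = refl
χ-sum (suc t) d = begin
  χ d + (χ (1 ℕ.+ d) + (χ (2 ℕ.+ d) + S (t ℕ.* 3) (λ j → χ (j ℕ.+ d))))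
    ≡⟨ solve 4 (λ a b c d → a :+ (b :+ (c :+ d)) := a :+ b :+ c :+ d) refl (χ d) _ _ _ ⟩
  χ d + χ (1 ℕ.+ d) + χ (2 ℕ.+ d) + S (t ℕ.* 3) (λ j → χ (j ℕ.+ d))
    ≡⟨ cong₂ _+_ (χ-total d) (χ-sum t d) ⟩
  1ℚ + ι t ∎

χ-split : ∀ {N} (x : Vector ℚ N) → sum (λ i → χ (toℕ i ℕ.+ 0) * x i)
  + sum (λ i → χ (toℕ i ℕ.+ 1) * x i) + sum (λ i → χ (toℕ i ℕ.+ 2) * x i) ≡ sum x
χ-split x = begin
  sum (λ i → χ (toℕ i ℕ.+ 0) * x i) + sum (λ i → χ (toℕ i ℕ.+ 1) * x i) + sum (λ i → χ (toℕ i ℕ.+ 2) * x i)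
    ≡⟨ cong (_+ sum (λ i → χ (toℕ i ℕ.+ 2) * x i)) (∑-distrib-+ (λ i → χ (toℕ i ℕ.+ 0) * x i) _) ⟨
  sum (λ i → χ (toℕ i ℕ.+ 0) * x i + χ (toℕ i ℕ.+ 1) * x i) + sum (λ i → χ (toℕ i ℕ.+ 2) * x i)
    ≡⟨ ∑-distrib-+ (λ i → χ (toℕ i ℕ.+ 0) * x i + χ (toℕ i ℕ.+ 1) * x i) _ ⟨
  sum (λ i → χ (toℕ i ℕ.+ 0) * x i + χ (toℕ i ℕ.+ 1) * x i + χ (toℕ i ℕ.+ 2) * x i)
    ≡⟨ sum-cong-≗ (λ i → trans (solve 4 (λ a b c y → a :* y :+ b :* y :+ c :* y := (a :+ b :+ c) :* y) refl
                                (χ (toℕ i ℕ.+ 0)) (χ (toℕ i ℕ.+ 1)) (χ (toℕ i ℕ.+ 2)) (x i))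
                         (trans (cong (_* x i) (total (toℕ i))) (ℚ.*-identityˡ (x i)))) ⟩
  sum x ∎
  where
  total : ∀ j → χ (j ℕ.+ 0) + χ (j ℕ.+ 1) + χ (j ℕ.+ 2) ≡ 1ℚ
  total j = trans (cong₂ _+_ (cong₂ _+_ (cong χ (ℕ.+-comm j 0)) (cong χ (ℕ.+-comm j 1))) (cong χ (ℕ.+-comm j 2))) (χ-total j)

-- Kronecker delta on ℕ

δ : ℕ → ℕ → ℚ
δ i j = if does (i ℕ.≟ j) then 1ℚ else 0ℚ

δ-refl : ∀ {i j} → i ≡ j → δ i j ≡ 1ℚ
δ-refl {i} {j} i≡j rewrite dec-true (i ℕ.≟ j) i≡j = refl

δ-≢ : ∀ {i j} → i ≢ j → δ i j ≡ 0ℚ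
δ-≢ {i} {j} i≢j rewrite dec-false (i ℕ.≟ j) i≢j = refl

S-δ-≥ : ∀ N i (f : ℕ → ℚ) → N ≤ i → S N (λ j → δ j i * f j) ≡ 0ℚ
S-δ-≥ N i f N≤i = sum-0 {N} (λ j → trans
  (cong (_* f (toℕ j)) (δ-≢ (ℕ.<⇒≢ (ℕ.<-≤-trans (Fin.toℕ<n j) N≤i)))) (ℚ.*-zeroˡ (f (toℕ j))))

S-δ-< : ∀ N i (f : ℕ → ℚ) → i < N → S N (λ j → δ j i * f j) ≡ f i
S-δ-< (suc N) i f i<1+N with i ℕ.≟ N
... | yes refl = begin
  S (suc N) (λ j → δ j N * f j)            ≡⟨ S-last N (λ j → δ j N * f j) ⟩
  S N (λ j → δ j N * f j) + δ N N * f N    ≡⟨ cong₂ (λ a b → a + b * f N) (S-δ-≥ N N f ℕ.≤-refl) (δ-refl {N} refl) ⟩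
  0ℚ + 1ℚ * f N                            ≡⟨ solve 1 (λ a → con 0ℚ :+ con 1ℚ :* a := a) refl (f N) ⟩
  f N                                      ∎
... | no i≢N = begin
  S (suc N) (λ j → δ j i * f j)            ≡⟨ S-last N (λ j → δ j i * f j) ⟩
  S N (λ j → δ j i * f j) + δ N i * f N    ≡⟨ cong₂ (λ a b → a + b * f N) (S-δ-< N i f (ℕ.≤∧≢⇒< (ℕ.≤-pred i<1+N) i≢N)) (δ-≢ (i≢N ∘ sym)) ⟩
  f i + 0ℚ * f N                           ≡⟨ solve 2 (λ a b → a :+ con 0ℚ :* b := a) refl (f i) (f N) ⟩
  f i                                      ∎

-- The functionals whose vanishing defines the column space

-- χ selects the residue class of -d mod 3 among the entries of v after the first.
φ : ∀ {N} → ℕ → Vector ℚ (suc N) → ℚ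
φ d v = v zero + ι 3 * sum (λ i → χ (toℕ i ℕ.+ d) * v (suc i))

φ-cong : ∀ {N} d {v w : Vector ℚ (suc N)} → v ≗ w → φ d v ≡ φ d w
φ-cong d v≗w = cong₂ (λ a b → a + ι 3 * b) (v≗w zero) (sum-cong-≗ (λ i → cong (χ (toℕ i ℕ.+ d) *_) (v≗w (suc i))))

φ-lincomb : ∀ {r N} d (a : Vector ℚ r) (b : Vector (Vector ℚ (suc N)) r) →
            φ d (lincomb a b) ≡ sum (λ k → a k * φ d (b k))
φ-lincomb d a b = begin
  sum (λ k → a k * b k zero) + ι 3 * sum (λ i → χ (toℕ i ℕ.+ d) * sum (λ k → a k * b k (suc i)))
    ≡⟨ cong (λ x → sum (λ k → a k * b k zero) + ι 3 * x) (trans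
         (sum-cong-≗ (λ i → *-distribˡ-sum (χ (toℕ i ℕ.+ d)) (λ k → a k * b k (suc i))))
         (∑-comm (λ i k → χ (toℕ i ℕ.+ d) * (a k * b k (suc i))))) ⟩
  sum (λ k → a k * b k zero) + ι 3 * sum (λ k → sum (λ i → χ (toℕ i ℕ.+ d) * (a k * b k (suc i))))
    ≡⟨ cong (sum (λ k → a k * b k zero) +_) (*-distribˡ-sum (ι 3) (λ k → sum (λ i → χ (toℕ i ℕ.+ d) * (a k * b k (suc i))))) ⟩
  sum (λ k → a k * b k zero) + sum (λ k → ι 3 * sum (λ i → χ (toℕ i ℕ.+ d) * (a k * b k (suc i))))
    ≡⟨ ∑-distrib-+ (λ k → a k * b k zero) _ ⟨
  sum (λ k → a k * b k zero + ι 3 * sum (λ i → χ (toℕ i ℕ.+ d) * (a k * b k (suc i))))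
    ≡⟨ sum-cong-≗ (λ k → trans
         (cong (λ x → a k * b k zero + ι 3 * x) (trans
           (sum-cong-≗ (λ i → solve 3 (λ x y z → x :* (y :* z) := y :* (x :* z)) refl (χ (toℕ i ℕ.+ d)) (a k) (b k (suc i))))
           (sym (*-distribˡ-sum (a k) (λ i → χ (toℕ i ℕ.+ d) * b k (suc i))))))
         (solve 4 (λ a b x y → a :* b :+ x :* (a :* y) := a :* (b :+ x :* y)) refl (a k) (b k zero) (ι 3) _)) ⟩
  sum (λ k → a k * φ d (b k)) ∎

span-φ : ∀ {r N} (b : Vector (Vector ℚ (suc N)) r) → (∀ k d → φ d (b k) ≡ 0ℚ) →
         ∀ {v} → v ∈Span b → ∀ d → φ d v ≡ 0ℚ
span-φ b φb≡0 {v} (a , ab≗v) d = begin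
  φ d v                          ≡⟨ φ-cong d ab≗v ⟨
  φ d (lincomb a b)              ≡⟨ φ-lincomb d a b ⟩
  sum (λ k → a k * φ d (b k))    ≡⟨ sum-0 (λ k → trans (cong (a k *_) (φb≡0 k d)) (ℚ.*-zeroʳ (a k))) ⟩
  0ℚ                             ∎

⅓ : ℚ
⅓ = ℤ.+ 1 / 3

-- Mod 3, the shift by -r is written as +2r: `χ (i + d)` becomes a function of `i + r` without
-- subtraction.
+-*3-regroup : ∀ i d r → i ℕ.+ d ℕ.+ r ℕ.* 3 ≡ i ℕ.+ r ℕ.+ (d ℕ.+ r ℕ.+ r)
+-*3-regroup = solve-∀

-- The circulant m/3 I + P through its periodic row

module Circulant (t′ : ℕ) where

  t m : ℕ
  t = suc t′
  m = t ℕ.* 3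

  β κ : ℚ
  β = ι 9 * ι t
  κ = ℤ.+ 1 / (3 ℕ.* m)

  -- The row continued with period m, so that a circulant entry is `W` at an index that need not be
  -- reduced.
  W : ℕ → ℚ
  W k = ζ β (k % m)

  κβ≡1 : κ * β ≡ 1ℚ
  κβ≡1 = begin
    κ * (ι 9 * ι t)       ≡⟨ cong (κ *_) (solve 1 (λ t → con (ι 9) :* t := con (ι 3) :* (t :* con (ι 3))) refl (ι t)) ⟩
    κ * (ι 3 * (ι t * ι 3)) ≡⟨ cong (λ x → κ * (ι 3 * x)) (ι-* t 3) ⟨
    κ * (ι 3 * ι m)       ≡⟨ cong (κ *_) (ι-* 3 m) ⟨
    κ * ι (3 ℕ.* m)       ≡⟨ 1/n*n≡1 (3 ℕ.* m) ⟩
    1ℚ                    ∎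

  β+β≡18t : β + β ≡ ι 18 * ι t
  β+β≡18t = solve 1 (λ t → con (ι 9) :* t :+ con (ι 9) :* t := con (ι 18) :* t) refl (ι t)

  W-periodic : Periodic m W
  W-periodic k = cong (ζ β) ([m+n]%n≡m%n k m)

  χ-periodic : Periodic m χ
  χ-periodic = χ-+3* t

  χ-% : ∀ k → χ (k % m) ≡ χ k
  χ-% k = begin
    χ (k % m)                               ≡⟨ χ-+3* (k ℕ./ m ℕ.* t) (k % m) ⟨
    χ (k % m ℕ.+ k ℕ./ m ℕ.* t ℕ.* 3)       ≡⟨ cong (λ x → χ (k % m ℕ.+ x)) (ℕ.*-assoc (k ℕ./ m) t 3) ⟩
    χ (k % m ℕ.+ k ℕ./ m ℕ.* m)             ≡⟨ cong χ (m≡m%n+[m/n]*n k m) ⟨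
    χ k                                     ∎

  %-suc : ∀ k → suc k % m ≡ suc (k % m) % m
  %-suc k = trans (cong (_% m) (cong suc (m≡m%n+[m/n]*n k m))) ([m+kn]%n≡m%n (suc (k % m)) (k ℕ./ m) m)

  -- Wrapping around is harmless: as 3 divides m, the sequence ζ continued to position m has the
  -- value 1 that it has at 0.
  W-suc : ∀ k → W (suc k) ≡ ζ β (suc (k % m))
  W-suc k with suc (k % m) ℕ.<? m
  ... | yes <m = cong (ζ β) (trans (%-suc k) (m<n⇒m%n≡m <m))
  ... | no  ≮m = begin
    ζ β (suc k % m)      ≡⟨ cong (ζ β) (trans (%-suc k) (trans (cong (_% m) eq) (n%n≡0 m))) ⟩
    1ℚ                   ≡⟨ ζ-3* β t ⟨
    ζ β m                ≡⟨ cong (ζ β) eq ⟨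
    ζ β (suc (k % m))    ∎
    where
    eq : suc (k % m) ≡ m
    eq = ℕ.≤-antisym (m%n<n k m) (ℕ.≮⇒≥ ≮m)

  W-pred : ∀ k j → k % m ≡ suc j → W (k ℕ.+ ℕ.pred m) ≡ ζ β j
  W-pred k j eq = cong (ζ β) (begin
    (k ℕ.+ ℕ.pred m) % m                 ≡⟨ %-distribˡ-+ k (ℕ.pred m) m ⟩
    (k % m ℕ.+ ℕ.pred m % m) % m         ≡⟨ cong (λ x → (x ℕ.+ ℕ.pred m % m) % m) (trans (sym (m%n%n≡m%n k m)) (cong (_% m) eq)) ⟩
    (suc j % m ℕ.+ ℕ.pred m % m) % m     ≡⟨ %-distribˡ-+ (suc j) (ℕ.pred m) m ⟨
    (suc j ℕ.+ ℕ.pred m) % m             ≡⟨ cong (_% m) (ℕ.+-suc j (ℕ.pred m)) ⟨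
    (j ℕ.+ m) % m                        ≡⟨ [m+n]%n≡m%n j m ⟩
    j % m                                ≡⟨ m<n⇒m%n≡m (ℕ.<-trans (ℕ.n<1+n j) (subst (_< m) eq (m%n<n k m))) ⟩
    j                                    ∎)

  -- Away from 0 this is `ζ-three` for the window starting at `k % m` - 1. At 0 both neighbours
  -- equal `ζ β 1` by reflection, and 2 · (β - 7)/2 + 1 = β - 6.
  W-three : ∀ k → W (suc k) + W k + W (k ℕ.+ ℕ.pred m) ≡ β * δ (k % m) 0 + (ι 3 - ι 9 * χ k)
  W-three k with k % m in eq
  ... | zero = begin
    W (suc k) + 1ℚ + W (k ℕ.+ ℕ.pred m)    ≡⟨ cong₂ (λ a b → a + 1ℚ + b) (trans (W-suc k) (cong (ζ β ∘ suc) eq)) last ⟩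
    ζ β 1 + 1ℚ + ζ β 1                     ≡⟨ solve 1 (λ b → con ½ :* (b :- con (ι 7)) :+ con 1ℚ :+ con ½ :* (b :- con (ι 7))
                                                := b :* con 1ℚ :+ (con (ι 3) :- con (ι 9) :* con 1ℚ)) refl β ⟩
    β * 1ℚ + (ι 3 - ι 9 * χ 0)             ≡⟨ cong (λ x → β * 1ℚ + (ι 3 - ι 9 * x)) (trans (cong χ (sym eq)) (χ-% k)) ⟩
    β * 1ℚ + (ι 3 - ι 9 * χ k)             ∎
    where
    last : W (k ℕ.+ ℕ.pred m) ≡ ζ β 1
    last = begin
      ζ β ((k ℕ.+ ℕ.pred m) % m)            ≡⟨ cong (ζ β) (%-distribˡ-+ k (ℕ.pred m) m) ⟩
      ζ β ((k % m ℕ.+ ℕ.pred m % m) % m)    ≡⟨ cong (λ x → ζ β ((x ℕ.+ ℕ.pred m % m) % m)) eq ⟩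
      ζ β ((ℕ.pred m % m) % m)              ≡⟨ cong (ζ β) (trans (m%n%n≡m%n (ℕ.pred m) m) (m<n⇒m%n≡m (ℕ.n<1+n (ℕ.pred m)))) ⟩
      ζ β (ℕ.pred m)                        ≡⟨ ζ-sym β β t 1 (ℕ.pred m) refl β+β≡18t ⟨
      ζ β 1                                 ∎
  ... | suc j = begin
    W (suc k) + ζ β (suc j) + W (k ℕ.+ ℕ.pred m)    ≡⟨ cong₂ (λ a b → a + ζ β (suc j) + b) (trans (W-suc k) (cong (ζ β ∘ suc) eq)) (W-pred k j eq) ⟩
    ζ β (2 ℕ.+ j) + ζ β (1 ℕ.+ j) + ζ β j           ≡⟨ solve 3 (λ a b c → c :+ b :+ a := a :+ b :+ c) refl (ζ β j) (ζ β (1 ℕ.+ j)) (ζ β (2 ℕ.+ j)) ⟩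
    ζ β j + ζ β (1 ℕ.+ j) + ζ β (2 ℕ.+ j)           ≡⟨ ζ-three β j ⟩
    ι 3 - ι 9 * χ (suc j)                           ≡⟨ cong (λ x → ι 3 - ι 9 * x) (trans (cong χ (sym eq)) (χ-% k)) ⟩
    ι 3 - ι 9 * χ k                                 ≡⟨ solve 2 (λ a b → a := b :* con 0ℚ :+ a) refl _ β ⟩
    β * 0ℚ + (ι 3 - ι 9 * χ k)                      ∎

  -- The residues of a and b add up to a multiple of m below 2m: either both are 0, or they are
  -- mirror positions. Hence the circulant is symmetric, its transposed indices j + (m - i) and i +
  -- (m - j) having sum 2m.
  W-sym : ∀ a b → a ℕ.+ b ≡ 2 ℕ.* m → W a ≡ W b
  W-sym a b a+b≡2m with m%n≡0⇒n∣m (a % m ℕ.+ b % m) m (begin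
      (a % m ℕ.+ b % m) % m  ≡⟨ %-distribˡ-+ a b m ⟨
      (a ℕ.+ b) % m          ≡⟨ cong (_% m) a+b≡2m ⟩
      2 ℕ.* m % m            ≡⟨ n∣m⇒m%n≡0 (2 ℕ.* m) m (divides 2 refl) ⟩
      0                      ∎)
  ... | divides 0 eq = cong (ζ β) (trans (ℕ.m+n≡0⇒m≡0 (a % m) eq) (sym (ℕ.m+n≡0⇒n≡0 (a % m) eq)))
  ... | divides 1 eq = ζ-sym β β t (a % m) (b % m) (trans eq (ℕ.*-identityˡ m)) β+β≡18t
  ... | divides (suc (suc q)) eq = contradiction
          (ℕ.+-mono-< (m%n<n a m) (m%n<n b m))
          (ℕ.≤⇒≯ (ℕ.≤-trans (ℕ.+-monoʳ-≤ m (ℕ.m≤m+n m (q ℕ.* m))) (ℕ.≤-reflexive (sym eq))))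

  -- `S-shift` moves the sum to the first period and the class to that of `d′`; with β = 9t the
  -- brackets of `ζ-class` become 1, whatever the class.
  W-class : ∀ d s → S m (λ i → χ (i ℕ.+ d) * W (i ℕ.+ (m ∸ s))) ≡ ι t
  W-class d s = begin
    S m (λ i → χ (i ℕ.+ d) * W (i ℕ.+ r))
      ≡⟨ S-cong m (λ i _ → cong (_* W (i ℕ.+ r)) (χ-back i)) ⟩
    S m (λ i → χ (i ℕ.+ r ℕ.+ (d ℕ.+ r ℕ.+ r)) * W (i ℕ.+ r))
      ≡⟨ S-shift m (λ j → χ (j ℕ.+ d′) * W j) (λ j → cong₂ _*_ (per j) (W-periodic j)) r ⟩
    S m (λ j → χ (j ℕ.+ d′) * W j)
      ≡⟨ S-cong m (λ j j<m → cong (λ x → χ (j ℕ.+ d′) * ζ β x) (m<n⇒m%n≡m j<m)) ⟩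
    S m (λ j → χ (j ℕ.+ d′) * ζ β j)
      ≡⟨ ζ-class β t d′ ⟩
    ι t * (χ d′ + χ (1 ℕ.+ d′) * (½ * (β - β + ι 2)) + χ (2 ℕ.+ d′) * (½ * (β + ι 2 - β)))
      ≡⟨ solve 5 (λ t β x y z → t :* (x :+ y :* (con ½ :* (β :- β :+ con (ι 2))) :+ z :* (con ½ :* (β :+ con (ι 2) :- β)))
           := t :* (x :+ y :+ z)) refl (ι t) β (χ d′) (χ (1 ℕ.+ d′)) (χ (2 ℕ.+ d′)) ⟩
    ι t * (χ d′ + χ (1 ℕ.+ d′) + χ (2 ℕ.+ d′))
      ≡⟨ trans (cong (ι t *_) (χ-total d′)) (ℚ.*-identityʳ (ι t)) ⟩
    ι t ∎
    where
    r d′ : ℕ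
    r = m ∸ s
    d′ = d ℕ.+ r ℕ.+ r
    χ-back : ∀ i → χ (i ℕ.+ d) ≡ χ (i ℕ.+ r ℕ.+ d′)
    χ-back i = trans (sym (χ-+3* r (i ℕ.+ d))) (cong χ (+-*3-regroup i d r))
    per : ∀ j → χ (j ℕ.+ m ℕ.+ d′) ≡ χ (j ℕ.+ d′)
    per j = trans (cong χ (trans (ℕ.+-assoc j m d′) (trans (cong (j ℕ.+_) (ℕ.+-comm m d′)) (sym (ℕ.+-assoc j d′ m))))) (χ-periodic (j ℕ.+ d′))

  δ-index : ∀ i j → i < m → j < m → δ ((j ℕ.+ (m ∸ i)) % m) 0 ≡ δ j i
  δ-index i j i<m j<m with j ℕ.≟ i
  ... | yes refl = trans (δ-refl (trans (cong (_% m) (ℕ.m+[n∸m]≡n (ℕ.<⇒≤ i<m))) (n%n≡0 m))) (sym (δ-refl {j} refl))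
  ... | no  j≢i  = trans (δ-≢ (j≢i ∘ %≡0⇒≡)) (sym (δ-≢ j≢i))
    where
    %≡0⇒≡ : (j ℕ.+ (m ∸ i)) % m ≡ 0 → j ≡ i
    %≡0⇒≡ eq = begin
      j                                  ≡⟨ m<n⇒m%n≡m j<m ⟨
      j % m                              ≡⟨ [m+n]%n≡m%n j m ⟨
      (j ℕ.+ m) % m                      ≡⟨ cong (λ x → (j ℕ.+ x) % m) (ℕ.m∸n+n≡m (ℕ.<⇒≤ i<m)) ⟨
      (j ℕ.+ (m ∸ i ℕ.+ i)) % m          ≡⟨ cong (_% m) (ℕ.+-assoc j (m ∸ i) i) ⟨
      (j ℕ.+ (m ∸ i) ℕ.+ i) % m          ≡⟨ %-distribˡ-+ (j ℕ.+ (m ∸ i)) i m ⟩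
      ((j ℕ.+ (m ∸ i)) % m ℕ.+ i % m) % m ≡⟨ cong (λ x → (x ℕ.+ i % m) % m) eq ⟩
      i % m % m                          ≡⟨ m%n%n≡m%n i m ⟩
      i % m                              ≡⟨ m<n⇒m%n≡m i<m ⟩
      i                                  ∎

-- An explicit basis of the solutions of the three equations

I≡δ : ∀ {N} (i j : Fin N) → I N i j ≡ δ (toℕ j) (toℕ i)
I≡δ i j with i Fin.≟ j
... | yes i≡j = sym (δ-refl (cong toℕ (sym i≡j)))
... | no  i≢j = sym (δ-≢ (i≢j ∘ sym ∘ Fin.toℕ-injective))

sum-I : ∀ {N} (a : Vector ℚ N) j → sum (λ k → a k * I N k j) ≡ a j
sum-I {suc N} a zero = begin
  a zero * 1ℚ + sum (λ k → a (suc k) * 0ℚ)    ≡⟨ cong₂ _+_ (ℚ.*-identityʳ (a zero)) (sum-0 (λ k → ℚ.*-zeroʳ (a (suc k)))) ⟩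
  a zero + 0ℚ                                 ≡⟨ ℚ.+-identityʳ (a zero) ⟩
  a zero                                      ∎
sum-I {suc N} a (suc j) = begin
  a zero * 0ℚ + sum (λ k → a (suc k) * I N k j)    ≡⟨ cong₂ _+_ (ℚ.*-zeroʳ (a zero)) (sum-I (a ∘ suc) j) ⟩
  0ℚ + a (suc j)                                   ≡⟨ ℚ.+-identityˡ (a (suc j)) ⟩
  a (suc j)                                        ∎

I-sum : ∀ {N} (a : Vector ℚ N) j → sum (λ k → a k * I N j k) ≡ a j
I-sum {suc N} a zero = sum-I a zero
I-sum {suc N} a (suc j) = begin
  a zero * 0ℚ + sum (λ k → a (suc k) * I N j k)    ≡⟨ cong₂ _+_ (ℚ.*-zeroʳ (a zero)) (I-sum (a ∘ suc) j) ⟩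
  0ℚ + a (suc j)                                   ≡⟨ ℚ.+-identityˡ (a (suc j)) ⟩
  a (suc j)                                        ∎

-- The equations solved for the first three entries of x, one in each residue class: each is -v₀/3
-- minus the rest of its class. The remaining coordinates are free.
freeBasis : ∀ M → Vector (Vector ℚ (4 ℕ.+ M)) (suc M)
freeBasis M zero    = 1ℚ ∷ - ⅓ ∷ - ⅓ ∷ - ⅓ ∷ 0ᵥ
freeBasis M (suc k) = 0ℚ ∷ - χ (toℕ k) ∷ - χ (2 ℕ.+ toℕ k) ∷ - χ (1 ℕ.+ toℕ k) ∷ I M k

free : ∀ {M} → Vector ℚ (4 ℕ.+ M) → Vector ℚ (suc M)
free v zero    = v zero
free v (suc k) = v (suc (suc (suc (suc k))))

-- The free coordinates read off the coefficients, which gives independence at once.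
free-lincomb : ∀ {M} (a : Vector ℚ (suc M)) → free (lincomb a (freeBasis M)) ≗ a
free-lincomb {M} a zero = begin
  a zero * 1ℚ + sum (λ k → a (suc k) * 0ℚ)    ≡⟨ cong₂ _+_ (ℚ.*-identityʳ (a zero)) (sum-0 (λ k → ℚ.*-zeroʳ (a (suc k)))) ⟩
  a zero + 0ℚ                                 ≡⟨ ℚ.+-identityʳ (a zero) ⟩
  a zero                                      ∎
free-lincomb {M} a (suc j) = begin
  a zero * 0ℚ + sum (λ k → a (suc k) * I M k j)    ≡⟨ cong₂ _+_ (ℚ.*-zeroʳ (a zero)) (sum-I (a ∘ suc) j) ⟩
  0ℚ + a (suc j)                                   ≡⟨ ℚ.+-identityˡ (a (suc j)) ⟩
  a (suc j)                                        ∎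

φ-freeBasis : ∀ M k d → φ d (freeBasis M k) ≡ 0ℚ
φ-freeBasis M zero d = begin
  1ℚ + ι 3 * (χ d * - ⅓ + (χ (1 ℕ.+ d) * - ⅓ + (χ (2 ℕ.+ d) * - ⅓ + sum {M} (λ i → χ (toℕ i ℕ.+ d) * 0ℚ))))
    ≡⟨ cong (λ x → 1ℚ + ι 3 * (χ d * - ⅓ + (χ (1 ℕ.+ d) * - ⅓ + (χ (2 ℕ.+ d) * - ⅓ + x)))) (sum-0 {M} (λ i → ℚ.*-zeroʳ (χ (toℕ i ℕ.+ d)))) ⟩
  1ℚ + ι 3 * (χ d * - ⅓ + (χ (1 ℕ.+ d) * - ⅓ + (χ (2 ℕ.+ d) * - ⅓ + 0ℚ)))
    ≡⟨ solve 3 (λ x y z → con 1ℚ :+ con (ι 3) :* (x :* con (- ⅓) :+ (y :* con (- ⅓) :+ (z :* con (- ⅓) :+ con 0ℚ))) := con 1ℚ :- (x :+ y :+ z))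
         refl (χ d) (χ (1 ℕ.+ d)) (χ (2 ℕ.+ d)) ⟩
  1ℚ - (χ d + χ (1 ℕ.+ d) + χ (2 ℕ.+ d))    ≡⟨ cong (λ x → 1ℚ - x) (χ-total d) ⟩
  0ℚ ∎
φ-freeBasis M (suc k) d = begin
  0ℚ + ι 3 * (χ d * - χ κ₀ + (χ (1 ℕ.+ d) * - χ (2 ℕ.+ κ₀) + (χ (2 ℕ.+ d) * - χ (1 ℕ.+ κ₀) + sum (λ i → χ (toℕ i ℕ.+ d) * I M k i))))
    -- The unit vector contributes `χ (κ₀ + d)`; the addition formula spreads it over the three
    -- dependent coordinates.
    ≡⟨ cong (λ x → 0ℚ + ι 3 * (χ d * - χ κ₀ + (χ (1 ℕ.+ d) * - χ (2 ℕ.+ κ₀) + (χ (2 ℕ.+ d) * - χ (1 ℕ.+ κ₀) + x))))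
         (trans (I-sum (λ i → χ (toℕ i ℕ.+ d)) k) (χ-+ κ₀ d)) ⟩
  0ℚ + ι 3 * (χ d * - χ κ₀ + (χ (1 ℕ.+ d) * - χ (2 ℕ.+ κ₀) + (χ (2 ℕ.+ d) * - χ (1 ℕ.+ κ₀) +
    (χ d * χ κ₀ + χ (1 ℕ.+ d) * χ (2 ℕ.+ κ₀) + χ (2 ℕ.+ d) * χ (1 ℕ.+ κ₀)))))
    ≡⟨ solve 6 (λ x y z a b c → con 0ℚ :+ con (ι 3) :* (x :* :- a :+ (y :* :- b :+ (z :* :- c :+ (x :* a :+ y :* b :+ z :* c)))) := con 0ℚ)
         refl (χ d) (χ (1 ℕ.+ d)) (χ (2 ℕ.+ d)) (χ κ₀) (χ (2 ℕ.+ κ₀)) (χ (1 ℕ.+ κ₀)) ⟩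
  0ℚ ∎
  where κ₀ = toℕ k

-- φ 0, φ 2 and φ 1 determine the second, third and fourth coordinates from the others.
freeBasis-spans : ∀ {M} (v : Vector ℚ (4 ℕ.+ M)) → (∀ d → φ d v ≡ 0ℚ) → v ∈Span freeBasis M
freeBasis-spans {M} v φv≡0 = free v , eq
  where
  u : Vector ℚ M
  u k = v (suc (suc (suc (suc k))))

  Σχ : ℕ → ℚ
  Σχ d = sum (λ k → χ (toℕ k ℕ.+ d) * u k)

  -- The hypothesis singles out `w` as the one of the first three entries of x in the class selected
  -- by `d`; then `φ d v` = 0 is solved for `w`.
  dependent : ∀ d w → (χ d * v (suc zero) + (χ (1 ℕ.+ d) * v (suc (suc zero)) + (χ (2 ℕ.+ d) * v (suc (suc (suc zero))) + Σχ d))) ≡ w + Σχ d →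
    v zero * - ⅓ + sum (λ k → u k * - χ (d ℕ.+ toℕ k)) ≡ w
  dependent d w eq = begin
    v zero * - ⅓ + sum (λ k → u k * - χ (d ℕ.+ toℕ k))
      ≡⟨ cong (v zero * - ⅓ +_) (sum-cong-≗ (λ k → trans
           (cong (λ x → u k * - χ x) (ℕ.+-comm d (toℕ k)))
           (solve 2 (λ a b → a :* :- b := con (- 1ℚ) :* (b :* a)) refl (u k) (χ (toℕ k ℕ.+ d))))) ⟩
    v zero * - ⅓ + sum (λ k → - 1ℚ * (χ (toℕ k ℕ.+ d) * u k))
      ≡⟨ cong (v zero * - ⅓ +_) (*-distribˡ-sum (- 1ℚ) (λ k → χ (toℕ k ℕ.+ d) * u k)) ⟨
    v zero * - ⅓ + - 1ℚ * Σχ d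
      ≡⟨ solve 3 (λ a s w → a :* con (- ⅓) :+ con (- 1ℚ) :* s := w :- con ⅓ :* (a :+ con (ι 3) :* (w :+ s))) refl (v zero) (Σχ d) w ⟩
    w - ⅓ * (v zero + ι 3 * (w + Σχ d))
      ≡⟨ cong (λ x → w - ⅓ * (v zero + ι 3 * x)) eq ⟨
    w - ⅓ * φ d v
      ≡⟨ cong (λ x → w - ⅓ * x) (φv≡0 d) ⟩
    w - ⅓ * 0ℚ
      ≡⟨ solve 1 (λ w → w :- con ⅓ :* con 0ℚ := w) refl w ⟩
    w ∎

  eq : lincomb (free v) (freeBasis M) ≗ v
  eq zero = free-lincomb (free v) zero
  eq (suc zero) = dependent 0 (v (suc zero))
    (solve 4 (λ x y z s → con 1ℚ :* x :+ (con 0ℚ :* y :+ (con 0ℚ :* z :+ s)) := x :+ s) refl (v (suc zero)) (v (suc (suc zero))) (v (suc (suc (suc zero)))) (Σχ 0))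
  eq (suc (suc zero)) = dependent 2 (v (suc (suc zero)))
    (solve 4 (λ x y z s → con 0ℚ :* x :+ (con 1ℚ :* y :+ (con 0ℚ :* z :+ s)) := y :+ s) refl (v (suc zero)) (v (suc (suc zero))) (v (suc (suc (suc zero)))) (Σχ 2))
  eq (suc (suc (suc zero))) = dependent 1 (v (suc (suc (suc zero))))
    (solve 4 (λ x y z s → con 0ℚ :* x :+ (con 0ℚ :* y :+ (con 1ℚ :* z :+ s)) := z :+ s) refl (v (suc zero)) (v (suc (suc zero))) (v (suc (suc (suc zero)))) (Σχ 1))
  eq (suc (suc (suc (suc k)))) = free-lincomb (free v) (suc k)

-- The column space is the solution space

module ColumnSpace (t′ : ℕ) (L : Matrix (suc (Circulant.m t′)) (suc (Circulant.m t′)))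
  (L₀₀ : L zero zero ≡ ι (suc t′))
  (L₀ⱼ : ∀ j → L zero (suc j) ≡ - ⅓)
  (Lᵢ₀ : ∀ i → L (suc i) zero ≡ - ⅓)
  (Lᵢⱼ : ∀ i j → L (suc i) (suc j) ≡ Circulant.κ t′ * Circulant.W t′ (toℕ j ℕ.+ (Circulant.m t′ ∸ toℕ i)))
  where

  open Circulant t′

  φ-column : ∀ k d → φ d (transpose L k) ≡ 0ℚ
  φ-column zero d = begin
    L zero zero + ι 3 * sum (λ i → χ (toℕ i ℕ.+ d) * L (suc i) zero)
      ≡⟨ cong₂ (λ a b → a + ι 3 * b) L₀₀ (sum-cong-≗ (λ i → cong (χ (toℕ i ℕ.+ d) *_) (Lᵢ₀ i))) ⟩
    ι t + ι 3 * sum {m} (λ i → χ (toℕ i ℕ.+ d) * - ⅓)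
      ≡⟨ cong (λ x → ι t + ι 3 * x) (*-distribʳ-sum (- ⅓) (λ (i : Fin m) → χ (toℕ i ℕ.+ d))) ⟨
    ι t + ι 3 * (S m (λ i → χ (i ℕ.+ d)) * - ⅓)
      ≡⟨ cong (λ x → ι t + ι 3 * (x * - ⅓)) (χ-sum t d) ⟩
    ι t + ι 3 * (ι t * - ⅓)
      ≡⟨ solve 1 (λ t → t :+ con (ι 3) :* (t :* con (- ⅓)) := con 0ℚ) refl (ι t) ⟩
    0ℚ ∎
  φ-column (suc k) d = begin
    L zero (suc k) + ι 3 * sum (λ i → χ (toℕ i ℕ.+ d) * L (suc i) (suc k))
      ≡⟨ cong₂ (λ a b → a + ι 3 * b) (L₀ⱼ k) (sum-cong-≗ (λ i → trans
           (cong (χ (toℕ i ℕ.+ d) *_) (trans (Lᵢⱼ i k) (cong (κ *_) (swap i))))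
           (solve 3 (λ a b c → a :* (b :* c) := b :* (a :* c)) refl (χ (toℕ i ℕ.+ d)) κ (W (toℕ i ℕ.+ (m ∸ toℕ k)))))) ⟩
    - ⅓ + ι 3 * sum {m} (λ i → κ * (χ (toℕ i ℕ.+ d) * W (toℕ i ℕ.+ (m ∸ toℕ k))))
      ≡⟨ cong (λ x → - ⅓ + ι 3 * x) (*-distribˡ-sum κ (λ (i : Fin m) → χ (toℕ i ℕ.+ d) * W (toℕ i ℕ.+ (m ∸ toℕ k)))) ⟨
    - ⅓ + ι 3 * (κ * S m (λ i → χ (i ℕ.+ d) * W (i ℕ.+ (m ∸ toℕ k))))
      ≡⟨ cong (λ x → - ⅓ + ι 3 * (κ * x)) (W-class d (toℕ k)) ⟩
    - ⅓ + ι 3 * (κ * ι t)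
      ≡⟨ solve 2 (λ a t → con (- ⅓) :+ con (ι 3) :* (a :* t) := con ⅓ :* (a :* (con (ι 9) :* t) :- con 1ℚ)) refl κ (ι t) ⟩
    ⅓ * (κ * β - 1ℚ)
      ≡⟨ cong (λ x → ⅓ * (x - 1ℚ)) κβ≡1 ⟩
    0ℚ ∎
    where
    -- Down a column i enters with a minus sign; the symmetry of the circulant puts it into the form
    -- of `W-class`.
    swap : ∀ i → W (toℕ k ℕ.+ (m ∸ toℕ i)) ≡ W (toℕ i ℕ.+ (m ∸ toℕ k))
    swap i = W-sym (toℕ k ℕ.+ (m ∸ toℕ i)) (toℕ i ℕ.+ (m ∸ toℕ k)) (begin
      toℕ k ℕ.+ (m ∸ toℕ i) ℕ.+ (toℕ i ℕ.+ (m ∸ toℕ k))    ≡⟨ exchange (toℕ k) (m ∸ toℕ i) (toℕ i) (m ∸ toℕ k) ⟩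
      toℕ k ℕ.+ (m ∸ toℕ k) ℕ.+ (toℕ i ℕ.+ (m ∸ toℕ i))    ≡⟨ cong₂ ℕ._+_ (ℕ.m+[n∸m]≡n (Fin.toℕ≤n k)) (ℕ.m+[n∸m]≡n (Fin.toℕ≤n i)) ⟩
      m ℕ.+ m                                              ≡⟨ cong (m ℕ.+_) (ℕ.+-identityʳ m) ⟨
      2 ℕ.* m                                              ∎)
      where
      exchange : ∀ a b c d → a ℕ.+ b ℕ.+ (c ℕ.+ d) ≡ a ℕ.+ d ℕ.+ (c ℕ.+ b)
      exchange = solve-∀

  columns-span : ∀ v → (∀ d → φ d v ≡ 0ℚ) → v ∈Span transpose L
  columns-span v φv≡0 = (0ℚ ∷ (λ j → Y (toℕ j))) , eq
    where
    -- This is x continued periodically; `j + pred m` stands for j - 1, so neighbours need no case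
    -- split at the ends.
    X : ℕ → ℚ
    X j = v (suc (j mod m))

    X-toℕ : ∀ j → X (toℕ j) ≡ v (suc j)
    X-toℕ j = cong (v ∘ suc) (Fin.toℕ-injective (trans (Fin.toℕ-fromℕ< (m%n<n (toℕ j) m)) (m<n⇒m%n≡m (Fin.toℕ<n j))))

    X-periodic : Periodic m X
    X-periodic j = cong (v ∘ suc) (Fin.fromℕ<-cong _ _ ([m+n]%n≡m%n j m) (m%n<n (j ℕ.+ m) m) (m%n<n j m))

    Y : ℕ → ℚ
    Y j = X (j ℕ.+ ℕ.pred m) + X j + X (suc j)

    S-+ : ∀ f g → S m (λ j → f j + g j) ≡ S m f + S m g
    S-+ f g = ∑-distrib-+ {m} (f ∘ toℕ) (g ∘ toℕ)

    S-* : ∀ c f → S m (λ j → c * f j) ≡ c * S m f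
    S-* c f = sym (*-distribˡ-sum {m} c (f ∘ toℕ))

    σ : ℚ
    σ = S m X

    v₀+σ≡0 : v zero + σ ≡ 0ℚ
    v₀+σ≡0 = begin
      v zero + σ
        ≡⟨ cong (v zero +_) (trans (sum-cong-≗ X-toℕ) (sym (χ-split (v ∘ suc)))) ⟩
      v zero + (s 0 + s 1 + s 2)
        ≡⟨ solve 4 (λ v a b c → v :+ (a :+ b :+ c) := con ⅓ :* (v :+ con (ι 3) :* a :+ (v :+ con (ι 3) :* b) :+ (v :+ con (ι 3) :* c)))
             refl (v zero) (s 0) (s 1) (s 2) ⟩
      ⅓ * (φ 0 v + φ 1 v + φ 2 v)
        ≡⟨ cong (⅓ *_) (cong₂ _+_ (cong₂ _+_ (φv≡0 0) (φv≡0 1)) (φv≡0 2)) ⟩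
      0ℚ ∎
      where
      s : ℕ → ℚ
      s d = sum (λ i → χ (toℕ i ℕ.+ d) * v (suc i))

    -- C⁻¹ + I + C is self-adjoint for sums over a period: shifting the window moves it from x to
    -- the weights, which will be rows of L.
    S-Y : ∀ (w : ℕ → ℚ) → Periodic m w → S m (λ j → Y j * w j) ≡ S m (λ j → (w (suc j) + w j + w (j ℕ.+ ℕ.pred m)) * X j)
    S-Y w per = begin
      S m (λ j → Y j * w j)
        ≡⟨ S-cong m (λ j _ → solve 4 (λ a b c w → (a :+ b :+ c) :* w := a :* w :+ b :* w :+ c :* w) refl
             (X (j ℕ.+ ℕ.pred m)) (X j) (X (suc j)) (w j)) ⟩
      S m (λ j → X (j ℕ.+ ℕ.pred m) * w j + X j * w j + X (suc j) * w j)
        ≡⟨ trans (S-+ (λ j → X (j ℕ.+ ℕ.pred m) * w j + X j * w j) (λ j → X (suc j) * w j))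
             (cong (_+ S m (λ j → X (suc j) * w j)) (S-+ (λ j → X (j ℕ.+ ℕ.pred m) * w j) (λ j → X j * w j))) ⟩
      S m (λ j → X (j ℕ.+ ℕ.pred m) * w j) + S m (λ j → X j * w j) + S m (λ j → X (suc j) * w j)
        ≡⟨ cong₂ (λ a b → a + S m (λ j → X j * w j) + b) first third ⟩
      S m (λ j → X j * w (suc j)) + S m (λ j → X j * w j) + S m (λ j → X j * w (j ℕ.+ ℕ.pred m))
        ≡⟨ trans (S-+ (λ j → X j * w (suc j) + X j * w j) (λ j → X j * w (j ℕ.+ ℕ.pred m)))
             (cong (_+ S m (λ j → X j * w (j ℕ.+ ℕ.pred m))) (S-+ (λ j → X j * w (suc j)) (λ j → X j * w j))) ⟨
      S m (λ j → X j * w (suc j) + X j * w j + X j * w (j ℕ.+ ℕ.pred m))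
        ≡⟨ S-cong m (λ j _ → solve 4 (λ a b c x → x :* a :+ x :* b :+ x :* c := (a :+ b :+ c) :* x) refl
             (w (suc j)) (w j) (w (j ℕ.+ ℕ.pred m)) (X j)) ⟩
      S m (λ j → (w (suc j) + w j + w (j ℕ.+ ℕ.pred m)) * X j) ∎
      where
      suc+pred : ∀ f → Periodic m f → ∀ j → f (suc j ℕ.+ ℕ.pred m) ≡ f j
      suc+pred f p j = trans (cong f (sym (ℕ.+-suc j (ℕ.pred m)))) (p j)

      shift-pred : ∀ j → j ℕ.+ m ℕ.+ ℕ.pred m ≡ j ℕ.+ ℕ.pred m ℕ.+ m
      shift-pred j = trans (ℕ.+-assoc j m (ℕ.pred m)) (trans (cong (j ℕ.+_) (ℕ.+-comm m (ℕ.pred m))) (sym (ℕ.+-assoc j (ℕ.pred m) m)))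

      first : S m (λ j → X (j ℕ.+ ℕ.pred m) * w j) ≡ S m (λ j → X j * w (suc j))
      first = begin
        S m (λ j → X (j ℕ.+ ℕ.pred m) * w j)
          ≡⟨ S-shift m (λ j → X (j ℕ.+ ℕ.pred m) * w j) (λ j → cong₂ _*_ (trans (cong X (shift-pred j)) (X-periodic (j ℕ.+ ℕ.pred m))) (per j)) 1 ⟨
        S m (λ j → X (j ℕ.+ 1 ℕ.+ ℕ.pred m) * w (j ℕ.+ 1))
          ≡⟨ S-cong m (λ j _ → trans (cong (λ k → X (k ℕ.+ ℕ.pred m) * w k) (ℕ.+-comm j 1)) (cong (_* w (suc j)) (suc+pred X X-periodic j))) ⟩
        S m (λ j → X j * w (suc j)) ∎

      third : S m (λ j → X (suc j) * w j) ≡ S m (λ j → X j * w (j ℕ.+ ℕ.pred m))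
      third = begin
        S m (λ j → X (suc j) * w j)
          ≡⟨ S-cong m (λ j _ → trans (cong (λ k → X k * w (k ℕ.+ ℕ.pred m)) (ℕ.+-comm j 1)) (cong (X (suc j) *_) (suc+pred w per j))) ⟨
        S m (λ j → X (j ℕ.+ 1) * w (j ℕ.+ 1 ℕ.+ ℕ.pred m))
          ≡⟨ S-shift m (λ j → X j * w (j ℕ.+ ℕ.pred m)) (λ j → cong₂ _*_ (X-periodic j) (trans (cong w (shift-pred j)) (per (j ℕ.+ ℕ.pred m)))) 1 ⟩
        S m (λ j → X j * w (j ℕ.+ ℕ.pred m)) ∎

    eq : lincomb (0ℚ ∷ (λ j → Y (toℕ j))) (transpose L) ≗ v
    eq zero = begin
      0ℚ * L zero zero + sum (λ j → Y (toℕ j) * L zero (suc j))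
        ≡⟨ cong₂ _+_ (ℚ.*-zeroˡ (L zero zero)) (sum-cong-≗ (λ j → cong (Y (toℕ j) *_) (L₀ⱼ j))) ⟩
      0ℚ + S m (λ j → Y j * - ⅓)
        ≡⟨ cong (0ℚ +_) (S-Y (λ _ → - ⅓) (λ _ → refl)) ⟩
      0ℚ + S m (λ j → - 1ℚ * X j)
        ≡⟨ trans (ℚ.+-identityˡ _) (S-* (- 1ℚ) X) ⟩
      - 1ℚ * σ
        ≡⟨ solve 2 (λ v s → con (- 1ℚ) :* s := v :- (v :+ s)) refl (v zero) σ ⟩
      v zero - (v zero + σ)
        ≡⟨ cong (λ x → v zero - x) v₀+σ≡0 ⟩
      v zero - 0ℚ
        ≡⟨ ℚ.+-identityʳ (v zero) ⟩
      v zero ∎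
    eq (suc i) = begin
      0ℚ * L (suc i) zero + sum (λ j → Y (toℕ j) * L (suc i) (suc j))
        ≡⟨ cong₂ _+_ (ℚ.*-zeroˡ (L (suc i) zero)) (sum-cong-≗ (λ j → trans (cong (Y (toℕ j) *_) (Lᵢⱼ i j))
             (solve 3 (λ y k w → y :* (k :* w) := k :* (y :* w)) refl (Y (toℕ j)) κ (W (toℕ j ℕ.+ s))))) ⟩
      0ℚ + S m (λ j → κ * (Y j * W (j ℕ.+ s)))
        ≡⟨ trans (ℚ.+-identityˡ _) (S-* κ (λ j → Y j * W (j ℕ.+ s))) ⟩
      κ * S m (λ j → Y j * W (j ℕ.+ s))
        ≡⟨ cong (κ *_) (S-Y (λ j → W (j ℕ.+ s)) (λ j → trans (cong W (swap j m)) (W-periodic (j ℕ.+ s)))) ⟩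
      κ * S m (λ j → (W (suc j ℕ.+ s) + W (j ℕ.+ s) + W (j ℕ.+ ℕ.pred m ℕ.+ s)) * X j)
        ≡⟨ cong (κ *_) (S-cong m (λ j j<m → trans
             (cong (_* X j) (trans (cong (λ k → W (suc j ℕ.+ s) + W (j ℕ.+ s) + W k) (swap j (ℕ.pred m)))
               (trans (W-three (j ℕ.+ s)) (cong (λ x → β * x + (ι 3 - ι 9 * χ (j ℕ.+ s))) (δ-index (toℕ i) j (Fin.toℕ<n i) j<m)))))
             (solve 4 (λ b d c x → (b :* d :+ (con (ι 3) :- con (ι 9) :* c)) :* x := b :* (d :* x) :+ (con (ι 3) :* x :+ con (- ι 9) :* (c :* x)))
               refl β (δ j (toℕ i)) (χ (j ℕ.+ s)) (X j)))) ⟩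
      κ * S m (λ j → β * (δ j (toℕ i) * X j) + (ι 3 * X j + - ι 9 * (χ (j ℕ.+ s) * X j)))
        ≡⟨ cong (κ *_) (trans (S-+ (λ j → β * (δ j (toℕ i) * X j)) (λ j → ι 3 * X j + - ι 9 * (χ (j ℕ.+ s) * X j))) (cong₂ _+_ (S-* β (λ j → δ j (toℕ i) * X j))
             (trans (S-+ (λ j → ι 3 * X j) (λ j → - ι 9 * (χ (j ℕ.+ s) * X j))) (cong₂ _+_ (S-* (ι 3) X) (S-* (- ι 9) (λ j → χ (j ℕ.+ s) * X j)))))) ⟩
      κ * (β * S m (λ j → δ j (toℕ i) * X j) + (ι 3 * σ + - ι 9 * τ))
        ≡⟨ cong (λ x → κ * (β * x + (ι 3 * σ + - ι 9 * τ))) (trans (S-δ-< m (toℕ i) X (Fin.toℕ<n i)) (X-toℕ i)) ⟩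
      κ * (β * v (suc i) + (ι 3 * σ + - ι 9 * τ))
        -- Here 3σ - 9τ = 3 ((v₀ + σ) - (v₀ + 3τ)), and both brackets vanish.
        ≡⟨ solve 6 (λ k b v₀ v s t → k :* (b :* v :+ (con (ι 3) :* s :+ con (- ι 9) :* t))
             := k :* b :* v :+ k :* con (ι 3) :* (v₀ :+ s :- (v₀ :+ con (ι 3) :* t))) refl κ β (v zero) (v (suc i)) σ τ ⟩
      κ * β * v (suc i) + κ * ι 3 * (v zero + σ - (v zero + ι 3 * τ))
        ≡⟨ cong₂ _+_ (cong (_* v (suc i)) κβ≡1) (cong (κ * ι 3 *_) (cong₂ _-_ v₀+σ≡0
             (trans (cong (λ x → v zero + ι 3 * x) (sum-cong-≗ (λ j → cong (χ (toℕ j ℕ.+ s) *_) (X-toℕ j)))) (φv≡0 s)))) ⟩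
      1ℚ * v (suc i) + κ * ι 3 * 0ℚ
        ≡⟨ solve 2 (λ v k → con 1ℚ :* v :+ k :* con (ι 3) :* con 0ℚ := v) refl (v (suc i)) κ ⟩
      v (suc i) ∎
      where
      -- As 3 divides m, `χ (j + s)` selects the class of -s ≡ i, so `φ s` is the equation for the
      -- class of i.
      s : ℕ
      s = m ∸ toℕ i
      τ : ℚ
      τ = S m (λ j → χ (j ℕ.+ s) * X j)
      swap : ∀ j k → j ℕ.+ k ℕ.+ s ≡ j ℕ.+ s ℕ.+ k
      swap j k = trans (ℕ.+-assoc j k s) (trans (cong (j ℕ.+_) (ℕ.+-comm k s)) (sym (ℕ.+-assoc j s k)))

  hasRank : HasRank L (suc (t′ ℕ.* 3))
  hasRank = record
    { basis       = freeBasis (t′ ℕ.* 3)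
    ; inColSpace  = λ k → columns-span (freeBasis (t′ ℕ.* 3) k) (φ-freeBasis (t′ ℕ.* 3) k)
    ; independent = λ a ab≗0 k → trans (sym (free-lincomb a k)) (free-0 a ab≗0 k)
    ; spanning    = λ v v∈ → freeBasis-spans v (span-φ (transpose L) φ-column v∈)
    }
    where
    free-0 : ∀ a → lincomb a (freeBasis (t′ ℕ.* 3)) ≗ 0ᵥ → free (lincomb a (freeBasis (t′ ℕ.* 3))) ≗ 0ᵥ
    free-0 a ab≗0 zero    = ab≗0 zero
    free-0 a ab≗0 (suc k) = ab≗0 (suc (suc (suc (suc k))))

-- The first row of P in terms of ζ

module FirstRow (t′ : ℕ) where

  open Circulant t′

  n : ℕ
  n = suc m

  ι-m : ι m ≡ ι 3 * ι t
  ι-m = trans (ι-* t 3) (ℚ.*-comm (ι t) (ι 3))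

  -- With n = m + 1 this is 2n - n² = 1 - (n - 1)²: the 1 is `ζ β 0`, and -m² will cancel against
  -- m/3 I.
  diagCoeff≡ : diagCoeff n ≡ 1ℚ - ι m * ι m
  diagCoeff≡ = begin
    diagCoeff n                                          ≡⟨ /-homo-+ (ℤ.+ (2 ℕ.* n)) (ℤ.- (ℤ.+ (n ℕ.* n))) 1 ⟩
    ℤ.+ (2 ℕ.* n) / 1 + (ℤ.- (ℤ.+ (n ℕ.* n))) / 1        ≡⟨ cong (ℤ.+ (2 ℕ.* n) / 1 +_) (/-homo-neg (ℤ.+ (n ℕ.* n)) 1) ⟩
    ℤ.+ (2 ℕ.* n) / 1 - ℤ.+ (n ℕ.* n) / 1                ≡⟨ cong₂ _-_ (+/≡ι*1/ (2 ℕ.* n) 1) (+/≡ι*1/ (n ℕ.* n) 1) ⟩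
    ι (2 ℕ.* n) * 1ℚ - ι (n ℕ.* n) * 1ℚ                  ≡⟨ cong₂ (λ a b → a * 1ℚ - b * 1ℚ) (ι-* 2 n) (ι-* n n) ⟩
    ι 2 * ι n * 1ℚ - ι n * ι n * 1ℚ                      ≡⟨ solve 1 (λ m → con (ι 2) :* (con 1ℚ :+ m) :* con 1ℚ :- (con 1ℚ :+ m) :* (con 1ℚ :+ m) :* con 1ℚ
                                                              := con 1ℚ :- m :* m) refl (ι m) ⟩
    1ℚ - ι m * ι m                                       ∎

  -- With k = s + 1, 3n - 18k = (9t + 3) - 18s - 18 = β - 18s - 15.
  coeff≡ : ∀ d s → coeff d n (suc s) ≡ ½ * (β - ι 18 * ι s - ι 15 + ι d)
  coeff≡ d s = begin
    coeff d n (suc s)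
      ≡⟨ /-homo-+ (ℤ.+ (3 ℕ.* n) ℤ.- ℤ.+ (18 ℕ.* suc s)) (ℤ.+ d) 2 ⟩
    (ℤ.+ (3 ℕ.* n) ℤ.- ℤ.+ (18 ℕ.* suc s)) / 2 + ℤ.+ d / 2
      ≡⟨ cong (_+ ℤ.+ d / 2) (trans (/-homo-+ (ℤ.+ (3 ℕ.* n)) (ℤ.- (ℤ.+ (18 ℕ.* suc s))) 2) (cong (ℤ.+ (3 ℕ.* n) / 2 +_) (/-homo-neg (ℤ.+ (18 ℕ.* suc s)) 2))) ⟩
    ℤ.+ (3 ℕ.* n) / 2 - ℤ.+ (18 ℕ.* suc s) / 2 + ℤ.+ d / 2
      ≡⟨ cong₂ _+_ (cong₂ _-_ (+/≡ι*1/ (3 ℕ.* n) 2) (+/≡ι*1/ (18 ℕ.* suc s) 2)) (+/≡ι*1/ d 2) ⟩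
    ι (3 ℕ.* n) * ½ - ι (18 ℕ.* suc s) * ½ + ι d * ½
      ≡⟨ cong₂ (λ a b → a * ½ - b * ½ + ι d * ½) (trans (ι-* 3 n) (cong (λ x → ι 3 * (1ℚ + x)) ι-m)) (ι-* 18 (suc s)) ⟩
    ι 3 * (1ℚ + ι 3 * ι t) * ½ - ι 18 * ι (suc s) * ½ + ι d * ½
      ≡⟨ solve 3 (λ t s d → con (ι 3) :* (con 1ℚ :+ con (ι 3) :* t) :* con ½ :- con (ι 18) :* (con 1ℚ :+ s) :* con ½ :+ d :* con ½
           := con ½ :* (con (ι 9) :* t :- con (ι 18) :* s :- con (ι 15) :+ d)) refl (ι t) (ι s) (ι d) ⟩
    ½ * (β - ι 18 * ι s - ι 15 + ι d) ∎

  -- `c n k` with positions counted from 0, where its mirror symmetry is k ↔ m - k.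
  pair : ℕ → ℕ → ℚ
  pair k j = δ k j + δ (m ∸ k) j

  c≡ : ∀ k (j : Fin m) → k ≤ m → c n k j ≡ pair k (toℕ j)
  c≡ k j k≤m = cong₂ _+_ (cong (λ x → δ x (suc (toℕ j))) (ℕ.+-comm k 1)) (cong (λ x → δ x (suc (toℕ j))) (ℕ.+-∸-assoc 1 k≤m))

  term : ℕ → ℕ → ℚ
  term j l = pair (suc l) j * ζ β (suc l)

  coeff8-term : ∀ s (j : Fin m) → 3 ℕ.+ s ℕ.* 3 ≤ m → coeff 8 n (suc s) * c n (3 ℕ.* suc s ∸ 2) j ≡ term (toℕ j) (s ℕ.* 3)
  coeff8-term s j ≤m = begin
    coeff 8 n (suc s) * c n (3 ℕ.* suc s ∸ 2) j
      ≡⟨ cong₂ _*_ (coeff≡ 8 s) (trans (cong (λ k → c n (k ∸ 2) j) (ℕ.*-comm 3 (suc s)))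
           (c≡ (suc (s ℕ.* 3)) j (ℕ.≤-trans (ℕ.m≤n+m _ 2) ≤m))) ⟩
    ½ * (β - ι 18 * ι s - ι 15 + ι 8) * pair (suc (s ℕ.* 3)) (toℕ j)
      ≡⟨ solve 3 (λ b s x → con ½ :* (b :- con (ι 18) :* s :- con (ι 15) :+ con (ι 8)) :* x := x :* (con ½ :* (b :- con (ι 18) :* s :- con (ι 7))))
           refl β (ι s) (pair (suc (s ℕ.* 3)) (toℕ j)) ⟩
    pair (suc (s ℕ.* 3)) (toℕ j) * (½ * (β - ι 18 * ι s - ι 7))
      ≡⟨ cong (pair (suc (s ℕ.* 3)) (toℕ j) *_) (trans (sym (ζ-3*+1 β s)) (cong (ζ β) (ℕ.+-comm (s ℕ.* 3) 1))) ⟩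
    term (toℕ j) (s ℕ.* 3) ∎

  coeff4-term : ∀ s (j : Fin m) → 3 ℕ.+ s ℕ.* 3 ≤ m → - (coeff 4 n (suc s) * c n (3 ℕ.* suc s ∸ 1) j) ≡ term (toℕ j) (1 ℕ.+ s ℕ.* 3)
  coeff4-term s j ≤m = begin
    - (coeff 4 n (suc s) * c n (3 ℕ.* suc s ∸ 1) j)
      ≡⟨ cong₂ (λ a b → - (a * b)) (coeff≡ 4 s) (trans (cong (λ k → c n (k ∸ 1) j) (ℕ.*-comm 3 (suc s)))
           (c≡ (2 ℕ.+ s ℕ.* 3) j (ℕ.≤-trans (ℕ.m≤n+m _ 1) ≤m))) ⟩
    - (½ * (β - ι 18 * ι s - ι 15 + ι 4) * pair (2 ℕ.+ s ℕ.* 3) (toℕ j))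
      ≡⟨ solve 3 (λ b s x → :- (con ½ :* (b :- con (ι 18) :* s :- con (ι 15) :+ con (ι 4)) :* x) := x :* (con ½ :* (con (ι 11) :- (b :- con (ι 18) :* s))))
           refl β (ι s) (pair (2 ℕ.+ s ℕ.* 3) (toℕ j)) ⟩
    pair (2 ℕ.+ s ℕ.* 3) (toℕ j) * (½ * (ι 11 - (β - ι 18 * ι s)))
      ≡⟨ cong (pair (2 ℕ.+ s ℕ.* 3) (toℕ j) *_) (trans (sym (ζ-3*+2 β s)) (cong (ζ β) (ℕ.+-comm (s ℕ.* 3) 2))) ⟩
    term (toℕ j) (1 ℕ.+ s ℕ.* 3) ∎

  c-term : ∀ s (j : Fin m) → 3 ℕ.+ s ℕ.* 3 ≤ m → c n (3 ℕ.* suc s) j ≡ term (toℕ j) (2 ℕ.+ s ℕ.* 3)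
  c-term s j ≤m = begin
    c n (3 ℕ.* suc s) j                     ≡⟨ cong (λ k → c n k j) (ℕ.*-comm 3 (suc s)) ⟩
    c n (suc s ℕ.* 3) j                     ≡⟨ c≡ (suc s ℕ.* 3) j ≤m ⟩
    pair (suc s ℕ.* 3) (toℕ j)              ≡⟨ ℚ.*-identityʳ _ ⟨
    pair (suc s ℕ.* 3) (toℕ j) * 1ℚ         ≡⟨ cong (pair (suc s ℕ.* 3) (toℕ j) *_) (ζ-3* β (suc s)) ⟨
    term (toℕ j) (2 ℕ.+ s ℕ.* 3)            ∎

  S-term : ∀ M j → S M (term j) ≡ S M (λ l → δ (suc l) j * ζ β (suc l)) + S M (λ l → δ (m ∸ suc l) j * ζ β (suc l))
  S-term M j = trans (S-cong M (λ l _ → ℚ.*-distribʳ-+ (ζ β (suc l)) (δ (suc l) j) (δ (m ∸ suc l) j)))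
    (∑-distrib-+ {M} (λ i → δ (suc (toℕ i)) j * ζ β (suc (toℕ i))) _)

  S-term-0 : ∀ M → M < m → S M (term 0) ≡ 0ℚ
  S-term-0 M M<m = sum-0 {M} λ i → trans
    (cong (_* ζ β (suc (toℕ i))) (cong₂ _+_ (δ-≢ {suc (toℕ i)} {0} (λ ()))
      (δ-≢ (ℕ.m>n⇒m∸n≢0 (ℕ.≤-<-trans (Fin.toℕ<n i) M<m)))))
    (ℚ.*-zeroˡ (ζ β (suc (toℕ i))))

  -- Solves m - (l + 1) = j + 1 for the summation index l, so that the delta-sum lemmas apply.
  reflected : ∀ M j → M < m → suc j < m →
    S M (λ l → δ (m ∸ suc l) (suc j) * ζ β (suc l)) ≡ S M (λ l → δ l (m ∸ (2 ℕ.+ j)) * ζ β (suc l))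
  reflected M j M<m 1+j<m = S-cong M (λ l l<M → cong (_* ζ β (suc l)) (δ-reflect l l<M))
    where
    δ-reflect : ∀ l → l < M → δ (m ∸ suc l) (suc j) ≡ δ l (m ∸ (2 ℕ.+ j))
    δ-reflect l l<M with l ℕ.≟ m ∸ (2 ℕ.+ j)
    ... | yes refl = trans (δ-refl {m ∸ suc l} {suc j} (trans (cong (m ∸_) (sym (ℕ.+-∸-assoc 1 1+j<m))) (ℕ.m∸[m∸n]≡n (ℕ.<⇒≤ 1+j<m)))) (sym (δ-refl {l} refl))
    ... | no  l≢   = trans (δ-≢ {m ∸ suc l} {suc j} (λ eq → l≢ (begin
        l                            ≡⟨ cong ℕ.pred (ℕ.m∸[m∸n]≡n (ℕ.≤-trans l<M (ℕ.<⇒≤ M<m))) ⟨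
        ℕ.pred (m ∸ (m ∸ suc l))     ≡⟨ cong (λ x → ℕ.pred (m ∸ x)) eq ⟩
        ℕ.pred (m ∸ suc j)           ≡⟨ ℕ.pred[m∸n]≡m∸[1+n] m (suc j) ⟩
        m ∸ (2 ℕ.+ j)                ∎))) (sym (δ-≢ l≢))

  -- Position j + 1 is at most M, while mirror images lie at m - M or beyond, which exceeds M: only
  -- the direct half contributes.
  S-term-left : ∀ M j → 2 ℕ.* M < m → suc j < m → j < M → S M (term (suc j)) ≡ ζ β (suc j)
  S-term-left M j 2M<m 1+j<m j<M = begin
    S M (term (suc j))
      ≡⟨ trans (S-term M (suc j)) (cong₂ _+_ (S-δ-< M j (ζ β ∘ suc) j<M)
           (trans (reflected M j M<m 1+j<m) (S-δ-≥ M (m ∸ (2 ℕ.+ j)) (ζ β ∘ suc) M≤))) ⟩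
    ζ β (suc j) + 0ℚ    ≡⟨ ℚ.+-identityʳ (ζ β (suc j)) ⟩
    ζ β (suc j)         ∎
    where
    M<m : M < m
    M<m = ℕ.≤-<-trans (ℕ.m≤m+n M (M ℕ.+ 0)) 2M<m
    M≤ : M ≤ m ∸ (2 ℕ.+ j)
    M≤ = ℕ.m+n≤o⇒m≤o∸n M (ℕ.≤-trans (ℕ.≤-trans (ℕ.≤-reflexive (ℕ.+-suc M (suc j)))
      (s≤s (ℕ.+-monoʳ-≤ M (ℕ.≤-trans j<M (ℕ.m≤m+n M 0))))) 2M<m)

  -- Only the mirror half reaches this position, and `ζ-sym` identifies the reflected value.
  S-term-right : ∀ M j → M < m → suc j < m → M ≤ j → m ∸ (2 ℕ.+ j) < M → S M (term (suc j)) ≡ ζ β (suc j)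
  S-term-right M j M<m 1+j<m M≤j <M = begin
    S M (term (suc j))
      ≡⟨ trans (S-term M (suc j)) (cong₂ _+_ (S-δ-≥ M j (ζ β ∘ suc) M≤j)
           (trans (reflected M j M<m 1+j<m) (S-δ-< M (m ∸ (2 ℕ.+ j)) (ζ β ∘ suc) <M))) ⟩
    0ℚ + ζ β (suc (m ∸ (2 ℕ.+ j)))    ≡⟨ ℚ.+-identityˡ _ ⟩
    ζ β (suc (m ∸ (2 ℕ.+ j)))         ≡⟨ cong (ζ β) (ℕ.+-∸-assoc 1 1+j<m) ⟨
    ζ β (m ∸ suc j)                   ≡⟨ ζ-sym β β t (m ∸ suc j) (suc j) (ℕ.m∸n+n≡m (ℕ.<⇒≤ 1+j<m)) β+β≡18t ⟩
    ζ β (suc j)                       ∎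

  S-term-middle : ∀ M j → M < m → suc j < m → M ≤ j → M ≤ m ∸ (2 ℕ.+ j) → S M (term (suc j)) ≡ 0ℚ
  S-term-middle M j M<m 1+j<m M≤j M≤ =
    trans (S-term M (suc j)) (cong₂ _+_ (S-δ-≥ M j (ζ β ∘ suc) M≤j)
      (trans (reflected M j M<m 1+j<m) (S-δ-≥ M (m ∸ (2 ℕ.+ j)) (ζ β ∘ suc) M≤)))

  middle-bound : ∀ M j → suc j < m → M ≤ m ∸ (2 ℕ.+ j) → M ℕ.+ suc j < m
  middle-bound M j 1+j<m M≤ = subst (_≤ m) (ℕ.+-suc M (suc j))
    (ℕ.≤-trans (ℕ.+-monoˡ-≤ (2 ℕ.+ j) M≤) (ℕ.≤-reflexive (ℕ.m∸n+n≡m 1+j<m)))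

  diag-term : ∀ j → diagCoeff n * δ 1 (suc j) ≡ δ j 0 - ι m * ι m * δ j 0
  diag-term zero    = trans (ℚ.*-identityʳ (diagCoeff n)) (trans diagCoeff≡ (cong (λ x → 1ℚ - x) (sym (ℚ.*-identityʳ (ι m * ι m)))))
  diag-term (suc j) = solve 2 (λ a b → a :* con 0ℚ := con 0ℚ :- b :* b :* con 0ℚ) refl (diagCoeff n) (ι m)

  FirstRow : Vector ℚ m → Set
  FirstRow z = ∀ j → z j ≡ ζ β (toℕ j) - ι m * ι m * δ (toℕ j) 0

  assemble : ∀ j q → δ j 0 + q ≡ ζ β j → diagCoeff n * δ 1 (suc j) + q ≡ ζ β j - ι m * ι m * δ j 0
  assemble j q eq = begin
    diagCoeff n * δ 1 (suc j) + q             ≡⟨ cong (_+ q) (diag-term j) ⟩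
    δ j 0 - ι m * ι m * δ j 0 + q             ≡⟨ solve 3 (λ d m q → d :- m :* m :* d :+ q := d :+ q :- m :* m :* d) refl (δ j 0) (ι m) q ⟩
    δ j 0 + q - ι m * ι m * δ j 0             ≡⟨ cong (_- ι m * ι m * δ j 0) eq ⟩
    ζ β j - ι m * ι m * δ j 0                 ∎

-- Even n: the pairs fill all positions 1, ..., m - 1

module EvenFirstRow (p : ℕ) where
  open Circulant (p ℕ.* 2)
  open FirstRow (p ℕ.* 2)

  M : ℕ
  M = suc (p ℕ.* 3)

  m≡2M+1 : m ≡ suc (2 ℕ.* M)
  m≡2M+1 = eq p
    where
    eq : ∀ p → suc (p ℕ.* 2) ℕ.* 3 ≡ suc (2 ℕ.* suc (p ℕ.* 3))
    eq = solve-∀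

  2M<m : 2 ℕ.* M < m
  2M<m = ℕ.≤-reflexive (sym m≡2M+1)

  M<m : M < m
  M<m = ℕ.≤-<-trans (ℕ.m≤m+n M (M ℕ.+ 0)) 2M<m

  S-term≡ζ : ∀ j → j < m → δ j 0 + S M (term j) ≡ ζ β j
  S-term≡ζ zero    _ = cong (1ℚ +_) (S-term-0 M M<m)
  S-term≡ζ (suc j) 1+j<m = trans (ℚ.+-identityˡ _) (cases (j ℕ.<? M) (m ∸ (2 ℕ.+ j) ℕ.<? M))
    where
    cases : Dec (j < M) → Dec (m ∸ (2 ℕ.+ j) < M) → S M (term (suc j)) ≡ ζ β (suc j)
    cases (yes j<M) _         = S-term-left M j 2M<m 1+j<m j<M
    cases (no  j≮M) (yes <M)  = S-term-right M j M<m 1+j<m (ℕ.≮⇒≥ j≮M) <M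
    -- A position missed by both halves would have M + (j + 1) < 2M + 1, against M ≤ j.
    cases (no  j≮M) (no  ≮M)  = contradiction
      (subst (M ℕ.+ suc j <_) m≡2M+1 (middle-bound M j 1+j<m (ℕ.≮⇒≥ ≮M)))
      (ℕ.≤⇒≯ (subst (_≤ M ℕ.+ suc j) (cong suc (cong (M ℕ.+_) (sym (ℕ.+-identityʳ M)))) 
        (ℕ.≤-trans (s≤s (ℕ.+-monoʳ-≤ M (ℕ.≮⇒≥ j≮M))) (ℕ.≤-reflexive (sym (ℕ.+-suc M j))))))

  -- The lone final pair continues the pattern: at M = 3p + 1 the entry (β - 18p - 7)/2 with β =
  -- 9(2p + 1) is 1.
  last-term : ∀ (j : Fin m) → c n M j ≡ term (toℕ j) (p ℕ.* 3)
  last-term j = begin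
    c n M j                             ≡⟨ c≡ M j (ℕ.<⇒≤ M<m) ⟩
    pair M (toℕ j)                      ≡⟨ ℚ.*-identityʳ _ ⟨
    pair M (toℕ j) * 1ℚ                 ≡⟨ cong (pair M (toℕ j) *_) ζ≡1 ⟨
    term (toℕ j) (p ℕ.* 3)              ∎
    where
    ζ≡1 : ζ β M ≡ 1ℚ
    ζ≡1 = begin
      ζ β M                                    ≡⟨ cong (ζ β) (ℕ.+-comm (p ℕ.* 3) 1) ⟨
      ζ β (p ℕ.* 3 ℕ.+ 1)                      ≡⟨ ζ-3*+1 β p ⟩
      ½ * (ι 9 * (1ℚ + ι (p ℕ.* 2)) - ι 18 * ι p - ι 7)
        ≡⟨ cong (λ x → ½ * (ι 9 * (1ℚ + x) - ι 18 * ι p - ι 7)) (ι-* p 2) ⟩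
      ½ * (ι 9 * (1ℚ + ι p * ι 2) - ι 18 * ι p - ι 7)
        ≡⟨ solve 1 (λ p → con ½ :* (con (ι 9) :* (con 1ℚ :+ p :* con (ι 2)) :- con (ι 18) :* p :- con (ι 7)) := con 1ℚ) refl (ι p) ⟩
      1ℚ                                       ∎

  [n∸4]/6≡p : (n ∸ 4) ℕ./ 6 ≡ p
  [n∸4]/6≡p = trans (cong (ℕ._/ 6) (ℕ.*-assoc p 2 3)) (m*n/n≡m p 6)

  n≡ : n ≡ (2 ℕ.+ p ℕ.* 3) ℕ.* 2
  n≡ = eq p
    where
    eq : ∀ p → suc (suc (p ℕ.* 2) ℕ.* 3) ≡ (2 ℕ.+ p ℕ.* 3) ℕ.* 2
    eq = solve-∀

  n/2∸1≡M : n ℕ./ 2 ∸ 1 ≡ M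
  n/2∸1≡M = cong (_∸ 1) (trans (cong (ℕ._/ 2) n≡) (m*n/n≡m (2 ℕ.+ p ℕ.* 3) 2))

  firstRow : FirstRow (z₁ n)
  firstRow j = begin
    z₁ n j
      ≡⟨ cong₂ (λ N k → diagCoeff n * δ 1 (suc (toℕ j)) + ∑[1… N ] f j + c n k j) [n∸4]/6≡p n/2∸1≡M ⟩
    diagCoeff n * δ 1 (suc (toℕ j)) + ∑[1… p ] f j + c n M j
      ≡⟨ ℚ.+-assoc (diagCoeff n * δ 1 (suc (toℕ j))) (∑[1… p ] f j) (c n M j) ⟩
    diagCoeff n * δ 1 (suc (toℕ j)) + (∑[1… p ] f j + c n M j)
      ≡⟨ cong (diagCoeff n * δ 1 (suc (toℕ j)) +_) (cong₂ _+_
           (trans (S-cong p (λ s s<p → f≡ s s<p)) (sym (S-three p (term (toℕ j))))) (last-term j)) ⟩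
    diagCoeff n * δ 1 (suc (toℕ j)) + (S (p ℕ.* 3) (term (toℕ j)) + term (toℕ j) (p ℕ.* 3))
      ≡⟨ cong (diagCoeff n * δ 1 (suc (toℕ j)) +_) (S-last (p ℕ.* 3) (term (toℕ j))) ⟨
    diagCoeff n * δ 1 (suc (toℕ j)) + S M (term (toℕ j))
      ≡⟨ assemble (toℕ j) (S M (term (toℕ j))) (S-term≡ζ (toℕ j) (Fin.toℕ<n j)) ⟩
    ζ β (toℕ j) - ι m * ι m * δ (toℕ j) 0 ∎
    where
    f : ℕ → Vector ℚ m
    f k = coeff 8 n k *ᵥ c n (3 ℕ.* k ∸ 2) -ᵥ coeff 4 n k *ᵥ c n (3 ℕ.* k ∸ 1) +ᵥ c n (3 ℕ.* k)
    f≡ : ∀ s → s < p → f (suc s) j ≡ term (toℕ j) (s ℕ.* 3) + term (toℕ j) (1 ℕ.+ s ℕ.* 3) + term (toℕ j) (2 ℕ.+ s ℕ.* 3)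
    f≡ s s<p = cong₂ _+_ (cong₂ _+_ (coeff8-term s j ≤m) (coeff4-term s j ≤m)) (c-term s j ≤m)
      where
      ≤m : suc s ℕ.* 3 ≤ m
      ≤m = ℕ.*-monoˡ-≤ 3 (ℕ.≤-trans s<p (ℕ.≤-trans (ℕ.m≤m*n p 2) (ℕ.n≤1+n (p ℕ.* 2))))

-- Odd n: the pairs leave the middle position m/2

module OddFirstRow (p : ℕ) where
  open Circulant (suc (p ℕ.* 2))
  open FirstRow (suc (p ℕ.* 2))

  M : ℕ
  M = 2 ℕ.+ p ℕ.* 3

  m≡2M+2 : m ≡ 2 ℕ.+ 2 ℕ.* M
  m≡2M+2 = eq p
    where
    eq : ∀ p → suc (suc (p ℕ.* 2)) ℕ.* 3 ≡ 2 ℕ.+ 2 ℕ.* (2 ℕ.+ p ℕ.* 3)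
    eq = solve-∀

  2M<m : 2 ℕ.* M < m
  2M<m = ℕ.≤-trans (ℕ.n≤1+n _) (ℕ.≤-reflexive (sym m≡2M+2))

  M<m : M < m
  M<m = ℕ.≤-<-trans (ℕ.m≤m+n M (M ℕ.+ 0)) 2M<m

  -- Position M + 1 = m/2 is its own mirror image, so no pair reaches it; the single basis vector
  -- supplies its value, which is 1 because M + 1 is divisible by 3.
  S-term≡ζ : ∀ j → j < m → δ j 0 + (S M (term j) + δ (suc M) j) ≡ ζ β j
  S-term≡ζ zero    _ = cong (λ x → 1ℚ + (x + 0ℚ)) (S-term-0 M M<m)
  S-term≡ζ (suc j) 1+j<m = trans (ℚ.+-identityˡ _) (cases (j ℕ.<? M) (m ∸ (2 ℕ.+ j) ℕ.<? M))
    where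
    +0 : M ≢ j → S M (term (suc j)) ≡ ζ β (suc j) → S M (term (suc j)) + δ M j ≡ ζ β (suc j)
    +0 M≢j eq = trans (cong₂ _+_ eq (δ-≢ M≢j)) (ℚ.+-identityʳ (ζ β (suc j)))
    m∸[2+M]≡M : m ∸ (2 ℕ.+ M) ≡ M
    m∸[2+M]≡M = trans (cong (_∸ (2 ℕ.+ M)) m≡2M+2) (trans (ℕ.m+n∸m≡n M (M ℕ.+ 0)) (ℕ.+-identityʳ M))
    cases : Dec (j < M) → Dec (m ∸ (2 ℕ.+ j) < M) → S M (term (suc j)) + δ M j ≡ ζ β (suc j)
    cases (yes j<M) _        = +0 (ℕ.<⇒≢ j<M ∘ sym) (S-term-left M j 2M<m 1+j<m j<M)
    cases (no  j≮M) (yes <M) = +0 (λ { refl → ℕ.<-irrefl m∸[2+M]≡M <M }) (S-term-right M j M<m 1+j<m (ℕ.≮⇒≥ j≮M) <M)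
    cases (no  j≮M) (no  ≮M) = begin
      S M (term (suc j)) + δ M j    ≡⟨ cong₂ _+_ (S-term-middle M j M<m 1+j<m (ℕ.≮⇒≥ j≮M) (ℕ.≮⇒≥ ≮M)) (δ-refl M≡j) ⟩
      1ℚ                            ≡⟨ ζ-3* β (suc p) ⟨
      ζ β (suc M)                   ≡⟨ cong (ζ β ∘ suc) M≡j ⟩
      ζ β (suc j)                   ∎
      where
      M≡j : M ≡ j
      M≡j = ℕ.≤-antisym (ℕ.≮⇒≥ j≮M) (ℕ.+-cancelˡ-≤ (2 ℕ.+ M) j M (subst₂ _≤_
        (cong suc (ℕ.+-suc M j))
        (trans m≡2M+2 (cong (λ x → 2 ℕ.+ (M ℕ.+ x)) (ℕ.+-identityʳ M)))
        (middle-bound M j 1+j<m (ℕ.≮⇒≥ ≮M))))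

  m/6≡1+p : m ℕ./ 6 ≡ suc p
  m/6≡1+p = trans (cong (ℕ._/ 6) (ℕ.*-assoc (suc p) 2 3)) (m*n/n≡m (suc p) 6)

  [n∸7]/6≡p : (n ∸ 7) ℕ./ 6 ≡ p
  [n∸7]/6≡p = trans (cong (ℕ._/ 6) (ℕ.*-assoc p 2 3)) (m*n/n≡m p 6)

  [n+1]/2≡M+2 : (n ℕ.+ 1) ℕ./ 2 ≡ 2 ℕ.+ M
  [n+1]/2≡M+2 = trans (cong (ℕ._/ 2) (eq p)) (m*n/n≡m (2 ℕ.+ M) 2)
    where
    eq : ∀ p → suc (suc (suc (p ℕ.* 2)) ℕ.* 3) ℕ.+ 1 ≡ (2 ℕ.+ (2 ℕ.+ p ℕ.* 3)) ℕ.* 2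
    eq = solve-∀

  firstRow : FirstRow (z₂ n)
  firstRow j = begin
    z₂ n j
      ≡⟨ cong₂ _+_ (cong₂ (λ N N′ → D + ∑[1… N ] f j + ∑[1… N′ ] g j) m/6≡1+p [n∸7]/6≡p) (cong (λ k → δ k (suc (toℕ j))) [n+1]/2≡M+2) ⟩
    D + ∑[1… suc p ] f j + ∑[1… p ] g j + δ (suc M) (toℕ j)
      -- The first sum has one block more than the second: p full triples end at entry 3p, and the
      -- extra block adds 3p + 1 and 3p + 2 = M.
      ≡⟨ cong (λ x → D + x + ∑[1… p ] g j + δ (suc M) (toℕ j)) (S-last p (λ s → f (suc s) j)) ⟩
    D + (∑[1… p ] f j + f (suc p) j) + ∑[1… p ] g j + δ (suc M) (toℕ j)
      ≡⟨ cong (λ x → D + (∑[1… p ] f j + x) + ∑[1… p ] g j + δ (suc M) (toℕ j)) (f≡ p ℕ.≤-refl) ⟩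
    D + (∑[1… p ] f j + (T (p ℕ.* 3) + T (1 ℕ.+ p ℕ.* 3))) + ∑[1… p ] g j + δ (suc M) (toℕ j)
      ≡⟨ solve 6 (λ d f a b g e → d :+ (f :+ (a :+ b)) :+ g :+ e := d :+ (f :+ g :+ a :+ b :+ e)) refl
           D (∑[1… p ] f j) (T (p ℕ.* 3)) (T (1 ℕ.+ p ℕ.* 3)) (∑[1… p ] g j) (δ (suc M) (toℕ j)) ⟩
    D + (∑[1… p ] f j + ∑[1… p ] g j + T (p ℕ.* 3) + T (1 ℕ.+ p ℕ.* 3) + δ (suc M) (toℕ j))
      ≡⟨ cong (λ x → D + (x + T (p ℕ.* 3) + T (1 ℕ.+ p ℕ.* 3) + δ (suc M) (toℕ j))) (trans (sym (∑-distrib-+ {p} _ _))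
           (trans (S-cong p (λ s s<p → cong₂ _+_ (f≡ s (ℕ.m≤n⇒m≤1+n s<p)) (c-term s j (bound s (ℕ.m≤n⇒m≤1+n s<p))))) (sym (S-three p T)))) ⟩
    D + (S (p ℕ.* 3) T + T (p ℕ.* 3) + T (1 ℕ.+ p ℕ.* 3) + δ (suc M) (toℕ j))
      ≡⟨ cong (λ x → D + (x + δ (suc M) (toℕ j))) (trans (S-last (suc (p ℕ.* 3)) T) (cong (_+ T (1 ℕ.+ p ℕ.* 3)) (S-last (p ℕ.* 3) T))) ⟨
    D + (S M T + δ (suc M) (toℕ j))
      ≡⟨ assemble (toℕ j) (S M T + δ (suc M) (toℕ j)) (S-term≡ζ (toℕ j) (Fin.toℕ<n j)) ⟩
    ζ β (toℕ j) - ι m * ι m * δ (toℕ j) 0 ∎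
    where
    D : ℚ
    D = diagCoeff n * δ 1 (suc (toℕ j))
    T : ℕ → ℚ
    T = term (toℕ j)
    f g : ℕ → Vector ℚ m
    f k = coeff 8 n k *ᵥ c n (3 ℕ.* k ∸ 2) -ᵥ coeff 4 n k *ᵥ c n (3 ℕ.* k ∸ 1)
    g k = c n (3 ℕ.* k)
    bound : ∀ s → s < suc p → suc s ℕ.* 3 ≤ m
    bound s s<1+p = ℕ.*-monoˡ-≤ 3 (ℕ.≤-trans s<1+p (s≤s (ℕ.≤-trans (ℕ.m≤m*n p 2) (ℕ.n≤1+n (p ℕ.* 2)))))
    f≡ : ∀ s → s < suc p → f (suc s) j ≡ T (s ℕ.* 3) + T (1 ℕ.+ s ℕ.* 3)
    f≡ s s<1+p = cong₂ _+_ (coeff8-term s j (bound s s<1+p)) (coeff4-term s j (bound s s<1+p))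

-- Joining the parities, and the entries of L̂

odd-n : ∀ p → ¬ 2 ∣ suc (suc (suc (p ℕ.* 2)) ℕ.* 3)
odd-n p 2∣n = contradiction (begin
  1                                       ≡⟨ [m+kn]%n≡m%n 1 (3 ℕ.+ p ℕ.* 3) 2 ⟨
  (1 ℕ.+ (3 ℕ.+ p ℕ.* 3) ℕ.* 2) % 2       ≡⟨ cong (_% 2) (n≡ p) ⟨
  suc (suc (suc (p ℕ.* 2)) ℕ.* 3) % 2     ≡⟨ n∣m⇒m%n≡0 _ 2 2∣n ⟩
  0                                       ∎) (λ ())
  where
  n≡ : ∀ p → suc (suc (suc (p ℕ.* 2)) ℕ.* 3) ≡ 1 ℕ.+ (3 ℕ.+ p ℕ.* 3) ℕ.* 2
  n≡ = solve-∀

-- n = 3t′ + 4 has the parity of t′, so halving t′ selects the formula.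
firstRow : ∀ t′ (let n = FirstRow.n t′) → FirstRow.FirstRow t′ (if does (2 ∣? n) then z₁ n else z₂ n)
firstRow t′ with t′ divMod 2
... | result p zero refl rewrite dec-true (2 ∣? FirstRow.n (p ℕ.* 2)) (divides (2 ℕ.+ p ℕ.* 3) (EvenFirstRow.n≡ p)) =
  EvenFirstRow.firstRow p
... | result p (suc zero) refl rewrite dec-false (2 ∣? FirstRow.n (suc (p ℕ.* 2))) (odd-n p) = OddFirstRow.firstRow p

module Entries (t′ : ℕ) where

  open Circulant t′
  open FirstRow t′ using (n; ι-m)

  m/3≡t : ℤ.+ m / 3 ≡ ι t
  m/3≡t = begin
    ℤ.+ m / 3           ≡⟨ +/≡ι*1/ m 3 ⟩
    ι m * ⅓             ≡⟨ cong (_* ⅓) ι-m ⟩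
    ι 3 * ι t * ⅓       ≡⟨ solve 1 (λ t → con (ι 3) :* t :* con ⅓ := t) refl (ι t) ⟩
    ι t                 ∎

  L̂₀₀ : L̂ n zero zero ≡ ι t
  L̂₀₀ = begin
    ℤ.+ m / 3 * 1ℚ - ⅓ * 0ℚ + 0ℚ    ≡⟨ solve 1 (λ a → a :* con 1ℚ :- con ⅓ :* con 0ℚ :+ con 0ℚ := a) refl (ℤ.+ m / 3) ⟩
    ℤ.+ m / 3                       ≡⟨ m/3≡t ⟩
    ι t                             ∎

  L̂₀ⱼ : ∀ j → L̂ n zero (suc j) ≡ - ⅓
  L̂₀ⱼ j = solve 1 (λ a → a :* con 0ℚ :- con ⅓ :* con 1ℚ :+ con 0ℚ := con (- ⅓)) refl (ℤ.+ m / 3)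

  L̂ᵢ₀ : ∀ i → L̂ n (suc i) zero ≡ - ⅓
  L̂ᵢ₀ i = solve 1 (λ a → a :* con 0ℚ :- con ⅓ :* con 1ℚ :+ con 0ℚ := con (- ⅓)) refl (ℤ.+ m / 3)

  -- On the diagonal the identity term and the -m² cancel: m² = tβ, so t - κm² = t(1 - κβ) = 0.
  L̂ᵢⱼ : ∀ i j → L̂ n (suc i) (suc j) ≡ κ * W (toℕ j ℕ.+ (m ∸ toℕ i))
  L̂ᵢⱼ i j = begin
    ℤ.+ m / 3 * I m i j - ⅓ * 0ℚ + κ * z (k mod m)
      ≡⟨ cong₂ (λ a b → a - ⅓ * 0ℚ + κ * b) (cong₂ _*_ m/3≡t (I≡δ i j))
           (trans (firstRow t′ (k mod m)) (cong₂ (λ x y → ζ β x - ι m * ι m * y) (Fin.toℕ-fromℕ< (m%n<n k m))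
             (trans (cong (λ x → δ x 0) (Fin.toℕ-fromℕ< (m%n<n k m))) (δ-index (toℕ i) (toℕ j) (Fin.toℕ<n i) (Fin.toℕ<n j))))) ⟩
    ι t * δᵢⱼ - ⅓ * 0ℚ + κ * (W k - ι m * ι m * δᵢⱼ)
      ≡⟨ cong (λ x → ι t * δᵢⱼ - ⅓ * 0ℚ + κ * (W k - x * x * δᵢⱼ)) ι-m ⟩
    ι t * δᵢⱼ - ⅓ * 0ℚ + κ * (W k - ι 3 * ι t * (ι 3 * ι t) * δᵢⱼ)
      ≡⟨ solve 4 (λ t d k w → t :* d :- con ⅓ :* con 0ℚ :+ k :* (w :- con (ι 3) :* t :* (con (ι 3) :* t) :* d)
           := k :* w :+ t :* d :* (con 1ℚ :- k :* (con (ι 9) :* t))) refl (ι t) δᵢⱼ κ (W k) ⟩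
    κ * W k + ι t * δᵢⱼ * (1ℚ - κ * β)
      ≡⟨ cong (λ x → κ * W k + ι t * δᵢⱼ * (1ℚ - x)) κβ≡1 ⟩
    κ * W k + ι t * δᵢⱼ * 0ℚ
      ≡⟨ solve 2 (λ a b → a :+ b :* con 0ℚ := a) refl (κ * W k) (ι t * δᵢⱼ) ⟩
    κ * W k ∎
    where
    k : ℕ
    k = toℕ j ℕ.+ (m ∸ toℕ i)
    δᵢⱼ : ℚ
    δᵢⱼ = δ (toℕ j) (toℕ i)
    z : Vector ℚ m
    z = if does (2 ∣? n) then z₁ n else z₂ n

  L̂-hasRank : HasRank (L̂ n) (n ∸ 3)
  L̂-hasRank = ColumnSpace.hasRank t′ (L̂ n) L̂₀₀ L̂₀ⱼ L̂ᵢ₀ L̂ᵢⱼ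

theorem6p14 : (n : ℕ) → 10 ≤ n → n % 3 ≡ 1 → HasRank (L̂ n) (n ∸ 3)
theorem6p14 n 10≤n n%3≡1 = go (n ℕ./ 3) n 10≤n (trans (m≡m%n+[m/n]*n n 3) (cong (ℕ._+ n ℕ./ 3 ℕ.* 3) n%3≡1))
  where
  go : ∀ q n → 10 ≤ n → n ≡ suc (q ℕ.* 3) → HasRank (L̂ n) (n ∸ 3)
  go zero     _ (s≤s ()) refl
  go (suc t′) _ _        refl = Entries.L̂-hasRank t′
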